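{- Let $X_1,X_2,X_3$ be i.i.d. real-valued random variables whose mean $\mathbb{E}[X_1]$ exists and is finite, and let $Y$ denote their median. Then $$\operatorname{Var}(Y) \le \mathbb{E}\big[(Y-\mathbb{E}[X_1])^2\big] \le 3\cdot\Big(\mathbb{E}\big[|X_1-\mathbb{E}[X_1]|\big]\Big)^2.$$
   Context: The median of three real numbers is the second smallest of them (counted with multiplicity). $\operatorname{Var}(Y)=\mathbb{E}[(Y-\mathbb{E}[Y])^2]$. -}

module Defs where

open import Algebra.Structures using (IsCommutativeRing)
open import Data.List.Base using (List; []; _∷_; map; foldr)
open import Data.List.Membership.Propositional using (_∈_)
open import Data.List.Relation.Binary.Permutation.Propositional using (_↭_)
open import Data.List.Relation.Unary.Unique.Propositional using (Unique)
open import Data.Nat.Base as ℕ using (ℕ; zero; suc)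
open import Data.Product.Base using (Σ-syntax; ∃-syntax; _×_)
open import Level using (0ℓ)
open import Relation.Binary.Bundles using (TotalOrder)
open import Relation.Binary.PropositionalEquality using (_≡_; _≢_)
open import Relation.Binary.Structures using (IsTotalOrder)
open import Relation.Unary
  using (Pred; U; ∁; ⋃; _∩_; _⊥_; _≐_; _⊢_; Satisfiable)
import Algebra.Construct.NaturalChoice.Max as Max
import Relation.Binary.Construct.NonStrictToStrict as Strict

-- The real numbers, characterised as a Dedekind-complete ordered field.
-- Together with excluded middle this determines ℝ up to isomorphism.

record RealField : Set₁ where
  infix  8 -_
  infixl 7 _*_
  infixl 6 _+_
  infix  4 _≤_

  field
    ℝ       : Set
    _+_ _*_ : ℝ → ℝ → ℝ
    -_      : ℝ → ℝ
    0ℝ 1ℝ   : ℝ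
    _≤_     : ℝ → ℝ → Set

  IsUpperBound : ∀ {ℓ} → Pred ℝ ℓ → ℝ → Set ℓ
  IsUpperBound P b = ∀ x → P x → x ≤ b

  IsSupremum : ∀ {ℓ} → Pred ℝ ℓ → ℝ → Set ℓ
  IsSupremum P s = IsUpperBound P s × (∀ b → IsUpperBound P b → s ≤ b)

  field
    isCommutativeRing : IsCommutativeRing _≡_ _+_ _*_ -_ 0ℝ 1ℝ
    0≢1               : 0ℝ ≢ 1ℝ
    inverse           : ∀ x → x ≢ 0ℝ → ∃[ y ] x * y ≡ 1ℝ
    isTotalOrder      : IsTotalOrder _≡_ _≤_
    +-monoˡ-≤         : ∀ z {x y} → x ≤ y → x + z ≤ y + z
    *-nonneg          : ∀ {x y} → 0ℝ ≤ x → 0ℝ ≤ y → 0ℝ ≤ x * y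
    complete          : (P : Pred ℝ 0ℓ) → Satisfiable P → Satisfiable (IsUpperBound P) →
                        ∃[ s ] IsSupremum P s

  totalOrder : TotalOrder 0ℓ 0ℓ 0ℓ
  totalOrder = record { isTotalOrder = isTotalOrder }

  open Max totalOrder public using (_⊔_)
  open Strict _≡_ _≤_ public using (_<_)

  infixl 6 _-_
  infix  9 _²

  _-_ : ℝ → ℝ → ℝ
  x - y = x + - y

  _² : ℝ → ℝ
  x ² = x * x

  ∣_∣ : ℝ → ℝ
  ∣ x ∣ = x ⊔ (- x)

  3ℝ : ℝ
  3ℝ = 1ℝ + 1ℝ + 1ℝ

  sum : List ℝ → ℝ
  sum = foldr _+_ 0ℝ

  partialSum : (ℕ → ℝ) → ℕ → ℝ
  partialSum a zero    = 0ℝ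
  partialSum a (suc n) = partialSum a n + a n

  HasSum : (ℕ → ℝ) → ℝ → Set
  HasSum a s = ∀ ε → 0ℝ < ε →
    ∃[ N ] (∀ n → N ℕ.≤ n → ∣ partialSum a n - s ∣ < ε)

  -- m is the second smallest of x, y, z, counted with multiplicity.
  IsMedian : ℝ → ℝ → ℝ → ℝ → Set
  IsMedian x y z m =
    ∃[ l ] ∃[ u ] (l ∷ m ∷ u ∷ []) ↭ (x ∷ y ∷ z ∷ []) × l ≤ m × m ≤ u

  -- The σ-algebra generated by the rays (-∞, c].  Predicates stand for
  -- subsets, so closure under extensional equality is part of the definition.
  data Borel : Pred ℝ 0ℓ → Set₁ where
    ray        : ∀ c → Borel (_≤ c)
    complement : ∀ {B} → Borel B → Borel (∁ B)
    union      : (B : ℕ → Pred ℝ 0ℓ) → (∀ n → Borel (B n)) → Borel (⋃ ℕ B)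
    resp       : ∀ {B C} → B ≐ C → Borel B → Borel C

-- ℙ is a total function on predicates for convenience; the axioms constrain
-- it on events only, and its other values are arbitrary.

record ProbabilitySpace (ℛ : RealField) : Set₂ where
  open RealField ℛ

  field
    Ω          : Set
    Event      : Pred Ω 0ℓ → Set₁
    Event-resp : ∀ {A B} → A ≐ B → Event A → Event B
    Event-U    : Event U
    Event-∁    : ∀ {A} → Event A → Event (∁ A)
    Event-⋃    : (A : ℕ → Pred Ω 0ℓ) → (∀ n → Event (A n)) → Event (⋃ ℕ A)

    ℙ          : Pred Ω 0ℓ → ℝ
    ℙ-resp     : ∀ {A B} → A ≐ B → Event A → ℙ A ≡ ℙ B
    ℙ-nonneg   : ∀ {A} → Event A → 0ℝ ≤ ℙ A
    ℙ-U        : ℙ U ≡ 1ℝ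
    ℙ-⋃        : (A : ℕ → Pred Ω 0ℓ) → (∀ n → Event (A n)) →
                 (∀ m n → m ≢ n → A m ⊥ A n) →
                 HasSum (λ n → ℙ (A n)) (ℙ (⋃ ℕ A))

  IsRandomVariable : (Ω → ℝ) → Set₁
  IsRandomVariable X = ∀ {B} → Borel B → Event (X ⊢ B)

  record IsSimple (s : Ω → ℝ) : Set₁ where
    field
      values    : List ℝ
      unique    : Unique values
      attained  : ∀ ω → s ω ∈ values
      level-set : ∀ {c} → c ∈ values → Event (λ ω → s ω ≡ c)

    -- Listed values that s never takes contribute 0.
    integral : ℝ
    integral = sum (map (λ c → c * ℙ (λ ω → s ω ≡ c)) values)

  LowerIntegral : (Ω → ℝ) → Pred ℝ _
  LowerIntegral f v =
    Σ[ s ∈ (Ω → ℝ) ] Σ[ simple ∈ IsSimple s ]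
      (∀ ω → 0ℝ ≤ s ω × s ω ≤ f ω) × v ≡ IsSimple.integral simple

  -- The Lebesgue integral of a nonnegative measurable f is finite, equal to v.
  HasIntegral⁺ : (Ω → ℝ) → ℝ → Set₁
  HasIntegral⁺ f v = IsSupremum (LowerIntegral f) v

  -- The expectation exists and is finite.
  record Integrable (X : Ω → ℝ) : Set₁ where
    field
      isRandomVariable : IsRandomVariable X
      𝔼⁺ 𝔼⁻            : ℝ
      positive-part    : HasIntegral⁺ (λ ω → X ω ⊔ 0ℝ) 𝔼⁺
      negative-part    : HasIntegral⁺ (λ ω → (- X ω) ⊔ 0ℝ) 𝔼⁻

  -- Suprema are unique, so the value does not depend on the second argument.
  𝔼 : (X : Ω → ℝ) → Integrable X → ℝ
  𝔼 X X-int = Integrable.𝔼⁺ X-int - Integrable.𝔼⁻ X-int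

  Var : (Y : Ω → ℝ) (Y-int : Integrable Y) →
        Integrable (λ ω → (Y ω - 𝔼 Y Y-int) ²) → ℝ
  Var Y Y-int = 𝔼 (λ ω → (Y ω - 𝔼 Y Y-int) ²)

  IdenticallyDistributed : (X Y : Ω → ℝ) → Set₁
  IdenticallyDistributed X Y = ∀ {B} → Borel B → ℙ (X ⊢ B) ≡ ℙ (Y ⊢ B)

  -- Mutual independence; pairwise independence is the case of one Bᵢ being ℝ.
  Independent₃ : (X₁ X₂ X₃ : Ω → ℝ) → Set₁
  Independent₃ X₁ X₂ X₃ = ∀ {B₁ B₂ B₃} → Borel B₁ → Borel B₂ → Borel B₃ →
    ℙ ((X₁ ⊢ B₁) ∩ (X₂ ⊢ B₂) ∩ (X₃ ⊢ B₃)) ≡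
    ℙ (X₁ ⊢ B₁) * ℙ (X₂ ⊢ B₂) * ℙ (X₃ ⊢ B₃)

  record IID₃ (X₁ X₂ X₃ : Ω → ℝ) : Set₁ where
    field
      isRandomVariable₁ : IsRandomVariable X₁
      isRandomVariable₂ : IsRandomVariable X₂
      isRandomVariable₃ : IsRandomVariable X₃
      identical₁₂       : IdenticallyDistributed X₁ X₂
      identical₁₃       : IdenticallyDistributed X₁ X₃
      independent       : Independent₃ X₁ X₂ X₃

-- Put Aᵢ = |Xᵢ - μ|.  If Y ≥ μ, then both Y and the largest of the Xᵢ are at
-- distance at least |Y - μ| from μ; if Y ≤ μ, both Y and the smallest are.  So
-- two of the Aᵢ are at least |Y - μ|, and (Y - μ)² ≤ A₁A₂ + A₂A₃ + A₁A₃.  By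
-- independence each product has expectation (E A₁)².  The first inequality is
-- the minimality of the second moment about the mean.
--
-- Finite additivity suffices.  An elementary function below f is bounded, so
-- to bound its integral f may be replaced by a rounding of f to multiples of δ,
-- capped at a large height.  Independence then concerns finite sums of products
-- of indicators, and δ tends to 0 at the end.

module Submission where

open import Defs
open import Algebra.Bundles using (CommutativeRing)
open import Algebra.Solver.Ring.AlmostCommutativeRing
  using (fromCommutativeRing; _-Raw-AlmostCommutative⟶_)
open import Axiom.ExcludedMiddle using (ExcludedMiddle)
open import Data.Integer.Base as ℤ using (ℤ; -[1+_]; _⊖_)
open import Data.List.Base using (List; []; _∷_; map; _++_; deduplicate)
open import Data.List.Membership.Propositional using (_∈_; _∉_)
open import Data.List.Membership.Propositional.Properties
  using (∈-map⁺; ∈-++⁺ˡ; ∈-++⁺ʳ; ∈-deduplicate⁺)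
open import Data.List.Relation.Binary.Permutation.Propositional as ↭ using (_↭_; ↭-sym)
open import Data.List.Relation.Binary.Permutation.Propositional.Properties using (Any-resp-↭)
open import Data.List.Relation.Unary.All as All using ()
open import Data.List.Relation.Unary.AllPairs using (_∷_)
open import Data.List.Relation.Unary.Any using (Any; here; there)
open import Data.List.Relation.Unary.Unique.DecPropositional.Properties using (deduplicate-!)
open import Data.List.Relation.Unary.Unique.Propositional using (Unique)
open import Data.Nat.Base as ℕ using (ℕ; zero; suc)
open import Data.Product.Base using (Σ-syntax; ∃-syntax; _×_; _,_; proj₁; proj₂)
open import Data.Sum.Base using (_⊎_; inj₁; inj₂; [_,_]′)
open import Function.Base using (_∘_; id)
open import Level using (0ℓ; Lift; lift; lower) renaming (suc to lsuc)
open import Relation.Binary.Bundles using (TotalOrder)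
open import Relation.Binary.PropositionalEquality
  using (_≡_; _≢_; refl; sym; trans; cong; cong₂; subst; subst₂; module ≡-Reasoning)
open import Relation.Nullary using (¬_; Dec; yes; no; contradiction)
open import Relation.Nullary.Decidable using (map′; dec⇒maybe; decidable-stable; True; toWitness; fromWitness)
open import Relation.Unary using (Pred; U; ∅; ∁; ⋃; _∩_; _∪_; _⊢_; _≐_; _⊥_)
import Algebra.Construct.NaturalChoice.Max as Max
import Algebra.Properties.Semiring.Mult.TCOptimised as Mult
import Algebra.Solver.Ring as RingSolver
import Data.Integer.Properties as ℤ
import Data.Maybe.Base as Maybe
import Data.Nat.Properties as ℕ

-- Integrals occur only as suprema over simple functions, and the proof works with one-sided
-- estimates of them. `Bounds f v` says that every elementary function below `f`, of whatever sign,
-- has integral at most `v`. This concerns finite sums only, so it can be proved before an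
-- expectation of `f` is known to exist, and completeness then supplies the expectation. In this way
-- the integrability of `Y` and of the squares comes out together with the inequalities.
--
-- The obstacle is subtraction: `𝔼 Y` is a difference of two suprema, and an estimate from above
-- says nothing about a term that is subtracted. In the expansion of the square about the mean, the
-- linear term is therefore split into positive and negative parts. The part that enters negatively
-- is moved to the other side of the inequality, where it is approached from below by the simple
-- functions that define its own supremum.

-- A ring solver for the reals with integer coefficients.

module IntegerCoefficients (ℛ : RealField) where
  open RealField ℛ

  commutativeRing : CommutativeRing 0ℓ 0ℓ
  commutativeRing = record { isCommutativeRing = isCommutativeRing }

  open CommutativeRing commutativeRing
    using (semiring; ring; +-abelianGroup; +-comm; +-assoc; +-identityˡ; +-identityʳ; -‿inverseʳ)
  open import Algebra.Properties.Ring ring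
    using (-‿distribˡ-*; -‿distribʳ-*; -0#≈0#; -‿involutive)
  open import Algebra.Properties.AbelianGroup +-abelianGroup using () renaming (⁻¹-∙-comm to -‿+-comm)
  open Mult semiring using (1+×; ×-homo-+; ×1-homo-*) renaming (_×_ to _×ₙ_)
  open ≡-Reasoning

  -- Equality of reals does not compute, so the solver takes its coefficients in ℤ, where equality
  -- is decided by evaluation. The optimised multiple `_×ₙ_` makes the image of 1 reduce to `1ℝ`, so
  -- `:1` denotes `1ℝ` on the nose.
  fromℤ : ℤ → ℝ
  fromℤ (ℤ.+ n)    = n ×ₙ 1ℝ
  fromℤ -[1+ n ] = - (suc n ×ₙ 1ℝ)

  cancel-suc : ∀ a b c → (a + b) - (a + c) ≡ b - c
  cancel-suc a b c = begin
    (a + b) + - (a + c)     ≡⟨ cong₂ _+_ (+-comm a b) (sym (-‿+-comm a c)) ⟩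
    (b + a) + (- a + - c)   ≡⟨ +-assoc b a _ ⟩
    b + (a + (- a + - c))   ≡⟨ cong (b +_) (sym (+-assoc a (- a) _)) ⟩
    b + ((a + - a) + - c)   ≡⟨ cong (λ z → b + (z + - c)) (-‿inverseʳ a) ⟩
    b + (0ℝ + - c)          ≡⟨ cong (b +_) (+-identityˡ _) ⟩
    b - c                   ∎

  ⊖-homo : ∀ m n → fromℤ (m ⊖ n) ≡ m ×ₙ 1ℝ - n ×ₙ 1ℝ
  ⊖-homo zero    zero    = sym (-‿inverseʳ 0ℝ)
  ⊖-homo zero    (suc n) = sym (+-identityˡ _)
  ⊖-homo (suc m) zero    = sym (trans (cong (suc m ×ₙ 1ℝ +_) -0#≈0#) (+-identityʳ _))
  ⊖-homo (suc m) (suc n) = begin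
    fromℤ (suc m ⊖ suc n)              ≡⟨ cong fromℤ (ℤ.[1+m]⊖[1+n]≡m⊖n m n) ⟩
    fromℤ (m ⊖ n)                      ≡⟨ ⊖-homo m n ⟩
    m ×ₙ 1ℝ - n ×ₙ 1ℝ                  ≡⟨ cancel-suc 1ℝ _ _ ⟨
    (1ℝ + m ×ₙ 1ℝ) - (1ℝ + n ×ₙ 1ℝ)    ≡⟨ cong₂ _-_ (1+× m 1ℝ) (1+× n 1ℝ) ⟨
    suc m ×ₙ 1ℝ - suc n ×ₙ 1ℝ          ∎

  neg-homo : ∀ i → fromℤ (ℤ.- i) ≡ - fromℤ i
  neg-homo (ℤ.+ zero)  = sym -0#≈0#
  neg-homo (ℤ.+ suc n) = refl
  neg-homo -[1+ n ]  = sym (-‿involutive _)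

  +-homo : ∀ i j → fromℤ (i ℤ.+ j) ≡ fromℤ i + fromℤ j
  +-homo (ℤ.+ m)    (ℤ.+ n)    = ×-homo-+ 1ℝ m n
  +-homo (ℤ.+ m)    -[1+ n ] = ⊖-homo m (suc n)
  +-homo -[1+ m ] (ℤ.+ n)    = trans (⊖-homo n (suc m)) (+-comm _ _)
  +-homo -[1+ m ] -[1+ n ] = begin
    - (suc (suc (m ℕ.+ n)) ×ₙ 1ℝ)       ≡⟨ cong (-_ ∘ (_×ₙ 1ℝ) ∘ suc) (sym (ℕ.+-suc m n)) ⟩
    - ((suc m ℕ.+ suc n) ×ₙ 1ℝ)         ≡⟨ cong -_ (×-homo-+ 1ℝ (suc m) (suc n)) ⟩
    - (suc m ×ₙ 1ℝ + suc n ×ₙ 1ℝ)       ≡⟨ -‿+-comm _ _ ⟨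
    - (suc m ×ₙ 1ℝ) - (suc n ×ₙ 1ℝ)     ∎

  *-homo⁺ : ∀ m j → fromℤ (ℤ.+ m ℤ.* j) ≡ m ×ₙ 1ℝ * fromℤ j
  *-homo⁺ m (ℤ.+ n)    = trans (cong fromℤ (sym (ℤ.pos-* m n))) (×1-homo-* m n)
  *-homo⁺ m -[1+ n ] = begin
    fromℤ (ℤ.+ m ℤ.* -[1+ n ])        ≡⟨ cong fromℤ (ℤ.neg-distribʳ-* (ℤ.+ m) (ℤ.+ suc n)) ⟨
    fromℤ (ℤ.- (ℤ.+ m ℤ.* ℤ.+ suc n))   ≡⟨ neg-homo (ℤ.+ m ℤ.* ℤ.+ suc n) ⟩
    - fromℤ (ℤ.+ m ℤ.* ℤ.+ suc n)       ≡⟨ cong -_ (*-homo⁺ m (ℤ.+ suc n)) ⟩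
    - (m ×ₙ 1ℝ * suc n ×ₙ 1ℝ)       ≡⟨ -‿distribʳ-* _ _ ⟩
    m ×ₙ 1ℝ * - (suc n ×ₙ 1ℝ)       ∎

  *-homo : ∀ i j → fromℤ (i ℤ.* j) ≡ fromℤ i * fromℤ j
  *-homo (ℤ.+ m)    j = *-homo⁺ m j
  *-homo -[1+ m ] j = begin
    fromℤ (-[1+ m ] ℤ.* j)         ≡⟨ cong fromℤ (ℤ.neg-distribˡ-* (ℤ.+ suc m) j) ⟨
    fromℤ (ℤ.- (ℤ.+ suc m ℤ.* j))    ≡⟨ neg-homo (ℤ.+ suc m ℤ.* j) ⟩
    - fromℤ (ℤ.+ suc m ℤ.* j)        ≡⟨ cong -_ (*-homo⁺ (suc m) j) ⟩
    - (suc m ×ₙ 1ℝ * fromℤ j)      ≡⟨ -‿distribˡ-* _ _ ⟩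
    - (suc m ×ₙ 1ℝ) * fromℤ j      ∎

  morphism : ℤ.+-*-rawRing -Raw-AlmostCommutative⟶ fromCommutativeRing commutativeRing
  morphism = record
    { ⟦_⟧    = fromℤ
    ; +-homo = +-homo
    ; *-homo = *-homo
    ; -‿homo = neg-homo
    ; 0-homo = refl
    ; 1-homo = refl
    }

  open RingSolver ℤ.+-*-rawRing (fromCommutativeRing commutativeRing) morphism
    (λ i j → Maybe.map (cong fromℤ) (dec⇒maybe (i ℤ.≟ j))) public
    using (solve; _:=_; _:+_; _:*_; _:-_; :-_; con; Polynomial)

  :0 :1 : ∀ {n} → Polynomial n
  :0 = con ℤ.0ℤ
  :1 = con ℤ.1ℤ

-- Order, completeness and approximation in the reals.

module Reals (em : ExcludedMiddle (lsuc 0ℓ)) (ℛ : RealField) where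
  open RealField ℛ
  open IntegerCoefficients ℛ using (solve; _:=_; _:+_; _:*_; _:-_; :-_; :0; :1)
  open TotalOrder totalOrder public using (total) renaming
    (refl to ≤-refl; reflexive to ≤-reflexive; trans to ≤-trans; antisym to ≤-antisym)
  open Max totalOrder public using (x≤x⊔y; x≤y⊔x; ⊔-lub; x≤y⇒x⊔y≈y; x≤y⇒y⊔x≈y)

  dec : (P : Set) → Dec P
  dec P = map′ lower lift (em {Lift (lsuc 0ℓ) P})

  -- Inequalities are proved by certificates: b - a is rewritten, by the ring
  -- solver, as a combination e of quantities known to be nonnegative.
  conclude : ∀ {a b e} → 0ℝ ≤ e → e ≡ b - a → a ≤ b
  conclude {a} {b} 0≤e refl = subst₂ _≤_
    (solve 1 (λ a → :0 :+ a := a) refl a)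
    (solve 2 (λ a b → b :- a :+ a := b) refl a b)
    (+-monoˡ-≤ a 0≤e)

  0≤diff : ∀ {a b} → a ≤ b → 0ℝ ≤ b - a
  0≤diff {a} {b} a≤b = subst (_≤ b - a)
    (solve 1 (λ a → a :- a := :0) refl a) (+-monoˡ-≤ (- a) a≤b)

  0≤neg : ∀ {a} → a ≤ 0ℝ → 0ℝ ≤ - a
  0≤neg {a} a≤0 = conclude (0≤diff a≤0) (solve 1 (λ a → :0 :- a := :- a :- :0) refl a)

  infixl 6 _⊕_
  infixl 7 _⊗_

  -- Named so that a proof of nonnegativity reads like the polynomial that it certifies.
  _⊕_ : ∀ {a b} → 0ℝ ≤ a → 0ℝ ≤ b → 0ℝ ≤ a + b
  _⊕_ {a} {b} 0≤a 0≤b = ≤-trans 0≤b (conclude 0≤a (solve 2 (λ a b → a := a :+ b :- b) refl a b))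

  _⊗_ : ∀ {a b} → 0ℝ ≤ a → 0ℝ ≤ b → 0ℝ ≤ a * b
  _⊗_ = *-nonneg

  +-mono-≤ : ∀ {a b c d} → a ≤ b → c ≤ d → a + c ≤ b + d
  +-mono-≤ {a} {b} {c} {d} a≤b c≤d = conclude (0≤diff a≤b ⊕ 0≤diff c≤d)
    (solve 4 (λ a b c d → (b :- a) :+ (d :- c) := b :+ d :- (a :+ c)) refl a b c d)

  *-mono-≤ : ∀ {a b c d} → 0ℝ ≤ a → 0ℝ ≤ c → a ≤ b → c ≤ d → a * c ≤ b * d
  *-mono-≤ {a} {b} {c} {d} 0≤a 0≤c a≤b c≤d =
    conclude (0≤diff a≤b ⊗ (0≤diff c≤d ⊕ 0≤c) ⊕ 0≤a ⊗ 0≤diff c≤d)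
      (solve 4 (λ a b c d → (b :- a) :* ((d :- c) :+ c) :+ a :* (d :- c) := b :* d :- a :* c) refl a b c d)

  *-monoˡ-≤ : ∀ {a b c} → 0ℝ ≤ c → a ≤ b → c * a ≤ c * b
  *-monoˡ-≤ {a} {b} {c} 0≤c a≤b = conclude (0≤c ⊗ 0≤diff a≤b)
    (solve 3 (λ a b c → c :* (b :- a) := c :* b :- c :* a) refl a b c)

  0≤² : ∀ a → 0ℝ ≤ a ²
  0≤² a with total 0ℝ a
  ... | inj₁ 0≤a = 0≤a ⊗ 0≤a
  ... | inj₂ a≤0 = subst (0ℝ ≤_) (solve 1 (λ a → (:- a) :* (:- a) := a :* a) refl a) (0≤neg a≤0 ⊗ 0≤neg a≤0)

  0≤1 : 0ℝ ≤ 1ℝ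
  0≤1 = subst (0ℝ ≤_) (solve 0 (:1 :* :1 := :1) refl) (0≤² 1ℝ)

  1≰0 : ¬ 1ℝ ≤ 0ℝ
  1≰0 1≤0 = 0≢1 (≤-antisym 0≤1 1≤0)

  ≰⇒≥ : ∀ {a b} → ¬ a ≤ b → b ≤ a
  ≰⇒≥ {a} {b} a≰b = [ (λ a≤b → contradiction a≤b a≰b) , id ]′ (total a b)

  ≰⇒> : ∀ {a b} → ¬ a ≤ b → b < a
  ≰⇒> a≰b = ≰⇒≥ a≰b , λ { refl → a≰b ≤-refl }

  <⇒≱ : ∀ {a b} → a < b → ¬ b ≤ a
  <⇒≱ (a≤b , a≢b) b≤a = a≢b (≤-antisym a≤b b≤a)

  0<diff : ∀ {a b} → a < b → 0ℝ < b - a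
  0<diff {a} {b} a<b = ≰⇒> λ b-a≤0 → <⇒≱ a<b (conclude (0≤neg b-a≤0)
    (solve 2 (λ a b → :- (b :- a) := a :- b) refl a b))

  1≤⇒0< : ∀ {a} → 1ℝ ≤ a → 0ℝ < a
  1≤⇒0< 1≤a = ≰⇒> λ a≤0 → 1≰0 (≤-trans 1≤a a≤0)

  positive-inverse : ∀ {a} → 0ℝ < a → ∃[ b ] 0ℝ ≤ b × a * b ≡ 1ℝ
  positive-inverse {a} (0≤a , 0≢a) with inverse a (0≢a ∘ sym)
  ... | b , ab≡1 with total 0ℝ b
  ...   | inj₁ 0≤b = b , 0≤b , ab≡1
  ...   | inj₂ b≤0 = contradiction
    (conclude (0≤a ⊗ 0≤neg b≤0)
      (trans (solve 2 (λ a b → a :* (:- b) := :0 :- a :* b) refl a b) (cong (λ c → 0ℝ - c) ab≡1)))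
    1≰0

  cancel-inverse : ∀ {a b} → a * b ≡ 1ℝ → ∀ x → b * (a * x) ≡ x
  cancel-inverse {a} {b} ab≡1 x = trans (solve 3 (λ a b x → b :* (a :* x) := a :* b :* x) refl a b x)
    (trans (cong (_* x) ab≡1) (solve 1 (λ x → :1 :* x := x) refl x))

  ∣∣-lub : ∀ {a b} → a ≤ b → - a ≤ b → ∣ a ∣ ≤ b
  ∣∣-lub = ⊔-lub

  a≤∣a∣ : ∀ a → a ≤ ∣ a ∣
  a≤∣a∣ a = x≤x⊔y a (- a)

  -a≤∣a∣ : ∀ a → - a ≤ ∣ a ∣
  -a≤∣a∣ a = x≤y⊔x a (- a)

  0≤∣a∣ : ∀ a → 0ℝ ≤ ∣ a ∣
  0≤∣a∣ a with total 0ℝ a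
  ... | inj₁ 0≤a = ≤-trans 0≤a (a≤∣a∣ a)
  ... | inj₂ a≤0 = ≤-trans (0≤neg a≤0) (-a≤∣a∣ a)

  infixl 7 _·_

  _·_ : ℕ → ℝ → ℝ
  zero  · δ = 0ℝ
  suc n · δ = n · δ + δ

  ·-nonneg : ∀ n {δ} → 0ℝ ≤ δ → 0ℝ ≤ n · δ
  ·-nonneg zero    0≤δ = ≤-refl
  ·-nonneg (suc n) 0≤δ = ·-nonneg n 0≤δ ⊕ 0≤δ

  -- Otherwise the multiples of `δ` have a supremum `s`. Since the successor of each multiple is
  -- also at most `s`, already `s - δ` is an upper bound, which contradicts leastness.
  archimedean : ∀ {δ} → 0ℝ < δ → ∀ a → ∃[ n ] a ≤ n · δ
  archimedean {δ} 0<δ a with dec (∃[ n ] a ≤ n · δ)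
  ... | yes bound = bound
  ... | no ¬bound = contradiction s≤s-δ λ s≤s-δ → <⇒≱ 0<δ (conclude (0≤diff s≤s-δ)
    (solve 2 (λ s δ → s :- δ :- s := :0 :- δ) refl s δ))
    where
    Multiple : ℝ → Set
    Multiple x = ∃[ n ] x ≡ n · δ

    sup = complete Multiple (0ℝ , zero , refl) (a , λ { _ (n , refl) → ≰⇒≥ λ a≤nδ → ¬bound (n , a≤nδ) })
    s   = proj₁ sup

    s≤s-δ : s ≤ s - δ
    s≤s-δ = proj₂ (proj₂ sup) (s - δ) λ { _ (n , refl) →
      conclude (0≤diff (proj₁ (proj₂ sup) (suc n · δ) (suc n , refl)))
        (solve 3 (λ s δ x → s :- (x :+ δ) := s :- δ :- x) refl s δ (n · δ)) }

  -- If `t = a - b` were positive, the choice `δ = t / (c + 1 + t)` would turn the hypothesis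
  -- `t ≤ δ * c` into `δ * (1 + t) ≤ 0`. This `δ` is at most 1, and the restriction to such `δ`
  -- allows callers to bound a quadratic error by a linear one.
  ≤-approx : ∀ {a b c} → 0ℝ ≤ c →
    (∀ δ → 0ℝ < δ → δ ≤ 1ℝ → a ≤ b + δ * c) → a ≤ b
  ≤-approx {a} {b} {c} 0≤c approx with dec (a ≤ b)
  ... | yes a≤b = a≤b
  ... | no  a≰b = contradiction δ≤0 (<⇒≱ 0<δ)
    where
    t = a - b
    0≤t = 0≤diff (≰⇒≥ a≰b)

    i-spec = positive-inverse {c + 1ℝ + t} (1≤⇒0< (conclude (0≤c ⊕ 0≤t)
      (solve 2 (λ c t → c :+ t := c :+ :1 :+ t :- :1) refl c t)))
    i      = proj₁ i-spec
    0≤i    = proj₁ (proj₂ i-spec)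
    inv    = proj₂ (proj₂ i-spec)
    δ      = t * i

    t≡ : δ * (c + 1ℝ + t) ≡ t
    t≡ = begin
      δ * (c + 1ℝ + t)    ≡⟨ solve 3 (λ c t i → t :* i :* (c :+ :1 :+ t) := t :* ((c :+ :1 :+ t) :* i)) refl c t i ⟩
      t * ((c + 1ℝ + t) * i) ≡⟨ cong (t *_) inv ⟩
      t * 1ℝ               ≡⟨ solve 1 (λ t → t :* :1 := t) refl t ⟩
      t                    ∎
      where open ≡-Reasoning

    0<δ : 0ℝ < δ
    0<δ = (0≤t ⊗ 0≤i) , λ 0≡δ → a≰b (conclude ≤-refl (begin
      0ℝ                                 ≡⟨ solve 2 (λ c t → :0 := :- (:0 :* (c :+ :1 :+ t))) refl c t ⟩
      - (0ℝ * (c + 1ℝ + t))              ≡⟨ cong (λ δ → - (δ * (c + 1ℝ + t))) 0≡δ ⟩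
      - (δ * (c + 1ℝ + t))               ≡⟨ cong -_ t≡ ⟩
      - (a - b)                          ≡⟨ solve 2 (λ a b → :- (a :- b) := b :- a) refl a b ⟩
      b - a                              ∎))
      where open ≡-Reasoning

    δ≤1 : δ ≤ 1ℝ
    δ≤1 = conclude ((0≤c ⊕ 0≤1) ⊗ 0≤i) (trans
      (solve 3 (λ c t i → (c :+ :1) :* i := (c :+ :1 :+ t) :* i :- t :* i) refl c t i)
      (cong (_- δ) inv))

    δ≤0 : δ ≤ 0ℝ
    δ≤0 = conclude (0≤diff (approx δ 0<δ δ≤1) ⊕ proj₁ 0<δ ⊗ 0≤t) (begin
      b + δ * c - a + δ * t
        ≡⟨ solve 5 (λ a b c δ t → b :+ δ :* c :- a :+ δ :* t
                    := :0 :- δ :+ (δ :* (c :+ :1 :+ t) :- (a :- b))) refl a b c δ t ⟩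
      0ℝ - δ + (δ * (c + 1ℝ + t) - t)   ≡⟨ cong (λ z → 0ℝ - δ + (z - t)) t≡ ⟩
      0ℝ - δ + (t - t)                   ≡⟨ solve 2 (λ δ t → :0 :- δ :+ (t :- t) := :0 :- δ) refl δ t ⟩
      0ℝ - δ                             ∎)
      where open ≡-Reasoning

-- σ-algebras, with Borel sets and events as instances, and measurable functions.

record SigmaAlgebra (A : Set) : Set₂ where
  field
    Measurable : Pred A 0ℓ → Set₁
    ≐-closed   : ∀ {P Q} → P ≐ Q → Measurable P → Measurable Q
    U-closed   : Measurable U
    ∁-closed   : ∀ {P} → Measurable P → Measurable (∁ P)
    ⋃-closed   : (P : ℕ → Pred A 0ℓ) → (∀ n → Measurable (P n)) → Measurable (⋃ ℕ P)

  ∅-closed : Measurable ∅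
  ∅-closed = ≐-closed ((λ ¬⊤ → ¬⊤ _) , λ ()) (∁-closed U-closed)

  ∪-closed : ∀ {P Q} → Measurable P → Measurable Q → Measurable (P ∪ Q)
  ∪-closed {P} {Q} mP mQ = ≐-closed (to , from) (⋃-closed pair measurable)
    where
    pair : ℕ → Pred A 0ℓ
    pair zero    = P
    pair (suc _) = Q

    measurable : ∀ n → Measurable (pair n)
    measurable zero    = mP
    measurable (suc _) = mQ

    to : ∀ {x} → ⋃ ℕ pair x → (P ∪ Q) x
    to (zero  , p) = inj₁ p
    to (suc _ , q) = inj₂ q

    from : ∀ {x} → (P ∪ Q) x → ⋃ ℕ pair x
    from (inj₁ p) = 0 , p
    from (inj₂ q) = 1 , q

module Measurability (em : ExcludedMiddle (lsuc 0ℓ)) (ℛ : RealField) where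
  open RealField ℛ
  open Reals em ℛ
  open IntegerCoefficients ℛ using (solve; _:=_; _:+_; _:*_; _:-_; :0; :1)
  open SigmaAlgebra

  ∩-closed : ∀ {A} (𝓐 : SigmaAlgebra A) {P Q} →
             Measurable 𝓐 P → Measurable 𝓐 Q → Measurable 𝓐 (P ∩ Q)
  ∩-closed 𝓐 {P} {Q} mP mQ = ≐-closed 𝓐
    ( (λ {x} ¬¬ → decidable-stable (dec (P x)) (¬¬ ∘ inj₁) , decidable-stable (dec (Q x)) (¬¬ ∘ inj₂))
    , λ (p , q) → [ (λ ¬p → ¬p p) , (λ ¬q → ¬q q) ]′ )
    (∁-closed 𝓐 (∪-closed 𝓐 (∁-closed 𝓐 mP) (∁-closed 𝓐 mQ)))

  ∁⁻-closed : ∀ {A} (𝓐 : SigmaAlgebra A) {P} → Measurable 𝓐 (∁ P) → Measurable 𝓐 P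
  ∁⁻-closed 𝓐 {P} m = ≐-closed 𝓐
    ((λ {x} → decidable-stable (dec (P x))) , λ p ¬p → ¬p p) (∁-closed 𝓐 m)

  -- The line is not among the generators; it is exhausted by the rays that end at natural numbers.
  Borel-U : Borel U
  Borel-U = resp ((λ _ → _) , λ {x} _ → total-ray x)
    (union rays λ n → ray (n · 1ℝ))
    where
    rays : ℕ → Pred ℝ 0ℓ
    rays n = _≤ n · 1ℝ

    total-ray : ∀ x → ⋃ ℕ rays x
    total-ray x = archimedean (1≤⇒0< ≤-refl) x

  borel : SigmaAlgebra ℝ
  borel = record
    { Measurable = Borel
    ; ≐-closed   = resp
    ; U-closed   = Borel-U
    ; ∁-closed   = complement
    ; ⋃-closed   = union
    }

  SublevelMeasurable : ∀ {A} → SigmaAlgebra A → (A → ℝ) → Set₁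
  SublevelMeasurable 𝓐 f = ∀ c → Measurable 𝓐 (λ x → f x ≤ c)

  -- Preimages commute with complements and unions, so induction on the generation of the Borel set
  -- leaves only the rays.
  preimage-measurable : ∀ {A} (𝓐 : SigmaAlgebra A) {f} → SublevelMeasurable 𝓐 f →
                        ∀ {B} → Borel B → Measurable 𝓐 (f ⊢ B)
  preimage-measurable 𝓐 mf (ray c)        = mf c
  preimage-measurable 𝓐 mf (complement b) = ∁-closed 𝓐 (preimage-measurable 𝓐 mf b)
  preimage-measurable 𝓐 {f} mf (union B b)    =
    ⋃-closed 𝓐 (λ n → f ⊢ B n) λ n → preimage-measurable 𝓐 mf (b n)
  preimage-measurable 𝓐 mf (resp (B⊆C , C⊆B) b) =
    ≐-closed 𝓐 ((λ p → B⊆C p) , λ p → C⊆B p) (preimage-measurable 𝓐 mf b)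

  ·-linear : ∀ n δ → n · δ ≡ n · 1ℝ * δ
  ·-linear zero    δ = solve 1 (λ δ → :0 := :0 :* δ) refl δ
  ·-linear (suc n) δ = trans (cong (_+ δ) (·-linear n δ))
    (solve 2 (λ m δ → m :* δ :+ δ := (m :+ :1) :* δ) refl (n · 1ℝ) δ)

  -- The open ray is the union of the closed rays that end at `s - 1/(n+1)`.
  Borel-below : ∀ s → Borel (_< s)
  Borel-below s = resp (below , λ {x} → above {x}) (union (λ n → _≤ s - recip n) λ n → ray _)
    where
    recip-spec : ∀ n → ∃[ r ] 0ℝ ≤ r × suc n · 1ℝ * r ≡ 1ℝ
    recip-spec n = positive-inverse (1≤⇒0< (conclude (·-nonneg n 0≤1)
      (solve 1 (λ m → m := m :+ :1 :- :1) refl (n · 1ℝ))))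

    recip : ℕ → ℝ
    recip n = proj₁ (recip-spec n)

    below : ∀ {x} → ⋃ ℕ (λ n → _≤ s - recip n) x → x < s
    below (n , x≤s-r) = ≤-trans x≤s-r (conclude 0≤r (solve 2 (λ s r → r := s :- (s :- r)) refl s r)) ,
      λ { refl → 1≰0 (conclude (·-nonneg (suc n) 0≤1 ⊗ 0≤diff x≤s-r)
        (trans (solve 3 (λ m s r → m :* (s :- r :- s) := :0 :- m :* r) refl (suc n · 1ℝ) s r)
               (cong (λ z → 0ℝ - z) (proj₂ (proj₂ (recip-spec n)))))) }
      where
      r   = recip n
      0≤r = proj₁ (proj₂ (recip-spec n))

    above : ∀ {x} → x < s → ⋃ ℕ (λ n → _≤ s - recip n) x
    -- With `d = s - x`, a natural `n` such that `1 ≤ n · d` also satisfies `1 ≤ suc n · d`, hence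
    -- `1/(n+1) ≤ d`.
    above {x} x<s with archimedean (0<diff x<s) 1ℝ
    ... | n , 1≤nd = n , conclude
      (proj₁ (proj₂ (recip-spec n)) ⊗ (0≤diff 1≤nd ⊕ proj₁ (0<diff x<s)))
      (begin
        r * (n · d - 1ℝ + d)       ≡⟨ cong (λ z → r * (z - 1ℝ + d)) (·-linear n d) ⟩
        r * (m * d - 1ℝ + d)
          ≡⟨ solve 3 (λ m r d → r :* (m :* d :- :1 :+ d) := (m :+ :1) :* r :* d :- r) refl m r d ⟩
        (m + 1ℝ) * r * d - r       ≡⟨ cong (λ z → z * d - r) (proj₂ (proj₂ (recip-spec n))) ⟩
        1ℝ * (s - x) - r
          ≡⟨ solve 3 (λ x s r → :1 :* (s :- x) :- r := s :- r :- x) refl x s r ⟩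
        s - r - x                  ∎)
      where
      open ≡-Reasoning
      r = recip n
      d = s - x
      m = n · 1ℝ

  -- Such a set is empty, the whole line, or a ray ending at its supremum, closed or open according
  -- to whether the supremum belongs to it.
  downward-closed⇒Borel : ∀ {P} → (∀ {x y} → x ≤ y → P y → P x) → Borel P
  downward-closed⇒Borel {P} down with dec (∃[ x ] P x)
  ... | no empty = resp ((λ ()) , λ {x} p → contradiction (x , p) empty) (∅-closed borel)
  ... | yes inhabited with dec (∃[ b ] IsUpperBound P b)
  ...   | no unbounded = resp ((λ {x} _ → everywhere x) , λ _ → _) Borel-U
    where
    everywhere : ∀ x → P x
    everywhere x = decidable-stable (dec (P x)) λ ¬p → unbounded (x , λ y p → ≰⇒≥ λ x≤y → ¬p (down x≤y p))
  ...   | yes bounded with complete P inhabited bounded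
  ...     | s , upper , least with dec (P s)
  ...       | yes p = resp ((λ x≤s → down x≤s p) , λ {x} → upper x) (ray s)
  ...       | no ¬p = resp (to , λ {x} q → upper x q , λ { refl → ¬p q }) (Borel-below s)
    where
    to : ∀ {x} → x < s → P x
    to {x} x<s = decidable-stable (dec (P x)) λ ¬q →
      <⇒≱ x<s (least x λ y q → ≰⇒≥ λ x≤y → ¬q (down x≤y q))

  -- Each branch is treated alone. Requiring `h x ≤ c` only to the right of `p` gives a downward
  -- closed set; requiring it only to the left gives an upward closed one. The sublevel set is their
  -- intersection. The positive and negative parts, the distance to a point and its square are all
  -- of this shape.
  valley⇒Borel : ∀ {h : ℝ → ℝ} p →
    (∀ {x y} → p ≤ x → x ≤ y → h x ≤ h y) →
    (∀ {x y} → y ≤ p → x ≤ y → h y ≤ h x) →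
    SublevelMeasurable borel h
  valley⇒Borel {h} p increasing decreasing c = resp (to , λ h≤c → (λ _ → h≤c) , λ _ → h≤c)
    (∩-closed borel
      (downward-closed⇒Borel {λ x → p ≤ x → h x ≤ c}
        λ x≤y h≤c p≤x → ≤-trans (increasing p≤x x≤y) (h≤c (≤-trans p≤x x≤y)))
      (∁⁻-closed borel {λ x → x ≤ p → h x ≤ c} (downward-closed⇒Borel
        λ x≤y ¬h≤c h≤c → ¬h≤c λ y≤p → ≤-trans (decreasing y≤p x≤y) (h≤c (≤-trans x≤y y≤p)))))
    where
    to : ∀ {x} → (p ≤ x → h x ≤ c) × (x ≤ p → h x ≤ c) → h x ≤ c
    to {x} (right , left) = [ right , left ]′ (total p x)

-- Linear combinations of indicators, and rounding by stairs.

module ElementaryFunctions (em : ExcludedMiddle (lsuc 0ℓ)) (ℛ : RealField) where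
  open RealField ℛ
  open Reals em ℛ
  open Measurability em ℛ
  open IntegerCoefficients ℛ using (solve; _:=_; _:+_; _:*_; _:-_; :-_; :0; :1)
  open SigmaAlgebra

  indicator : ∀ {P : Set} → Dec P → ℝ
  indicator (yes _) = 1ℝ
  indicator (no  _) = 0ℝ

  𝟙 : ∀ {A : Set} → Pred A 0ℓ → A → ℝ
  𝟙 P x = indicator (dec (P x))

  𝟙-∩ : ∀ {A} (P Q : Pred A 0ℓ) x → 𝟙 (P ∩ Q) x ≡ 𝟙 P x * 𝟙 Q x
  𝟙-∩ P Q x with dec ((P ∩ Q) x) | dec (P x) | dec (Q x)
  ... | yes _        | yes _ | yes _ = solve 0 (:1 := :1 :* :1) refl
  ... | yes (p , _)  | no ¬p | _     = contradiction p ¬p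
  ... | yes (_ , q)  | yes _ | no ¬q = contradiction q ¬q
  ... | no ¬pq       | yes p | yes q = contradiction (p , q) ¬pq
  ... | no _         | no _  | i     = solve 1 (λ i → :0 := :0 :* i) refl (indicator i)
  ... | no _         | yes _ | no _  = solve 0 (:0 := :1 :* :0) refl

  𝟙-yes : ∀ {A} (P : Pred A 0ℓ) x → P x → 𝟙 P x ≡ 1ℝ
  𝟙-yes P x p with dec (P x)
  ... | yes _ = refl
  ... | no ¬p = contradiction p ¬p

  𝟙-no : ∀ {A} (P : Pred A 0ℓ) x → ¬ P x → 𝟙 P x ≡ 0ℝ
  𝟙-no P x ¬p with dec (P x)
  ... | yes p = contradiction p ¬p
  ... | no _  = refl

  record Term {A : Set} (𝓐 : SigmaAlgebra A) : Set₁ where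
    constructor term
    field
      coefficient : ℝ
      {set}       : Pred A 0ℓ
      measurable  : Measurable 𝓐 set

  open Term public

  -- A formal expression rather than a function: the sets may overlap and the coefficients may have
  -- any sign. Integrals can thus be defined by recursion and independence applied term by term;
  -- `∫-cong` later shows that the integral depends only on the function denoted.
  Elementary : ∀ {A} → SigmaAlgebra A → Set₁
  Elementary 𝓐 = List (Term 𝓐)

  module _ {A : Set} {𝓐 : SigmaAlgebra A} where
    ⟦_⟧ : Elementary 𝓐 → A → ℝ
    ⟦ [] ⟧    x = 0ℝ
    ⟦ t ∷ L ⟧ x = coefficient t * 𝟙 (set t) x + ⟦ L ⟧ x

    constant : ℝ → Elementary 𝓐
    constant a = term a (U-closed 𝓐) ∷ []

    scale : ℝ → Elementary 𝓐 → Elementary 𝓐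
    scale a = map λ t → term (a * coefficient t) (measurable t)

    difference : Elementary 𝓐 → Elementary 𝓐 → Elementary 𝓐
    difference L M = L ++ scale (- 1ℝ) M

    restrict : Term 𝓐 → Elementary 𝓐 → Elementary 𝓐
    restrict s = map λ t → term (coefficient s * coefficient t) (∩-closed 𝓐 (measurable s) (measurable t))

    product : Elementary 𝓐 → Elementary 𝓐 → Elementary 𝓐
    product []      M = []
    product (t ∷ L) M = restrict t M ++ product L M

    ⟦++⟧ : ∀ L M x → ⟦ L ++ M ⟧ x ≡ ⟦ L ⟧ x + ⟦ M ⟧ x
    ⟦++⟧ []      M x = solve 1 (λ m → m := :0 :+ m) refl (⟦ M ⟧ x)
    ⟦++⟧ (t ∷ L) M x = trans (cong (coefficient t * 𝟙 (set t) x +_) (⟦++⟧ L M x))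
      (solve 3 (λ h l m → h :+ (l :+ m) := h :+ l :+ m) refl _ _ _)

    ⟦constant⟧ : ∀ a x → ⟦ constant a ⟧ x ≡ a
    ⟦constant⟧ a x = trans (cong (λ i → a * i + 0ℝ) (𝟙-yes U x _))
      (solve 1 (λ a → a :* :1 :+ :0 := a) refl a)

    ⟦scale⟧ : ∀ a L x → ⟦ scale a L ⟧ x ≡ a * ⟦ L ⟧ x
    ⟦scale⟧ a []      x = solve 1 (λ a → :0 := a :* :0) refl a
    ⟦scale⟧ a (t ∷ L) x = trans (cong (a * coefficient t * 𝟙 (set t) x +_) (⟦scale⟧ a L x))
      (solve 4 (λ a c i l → a :* c :* i :+ a :* l := a :* (c :* i :+ l)) refl a _ _ _)

    ⟦difference⟧ : ∀ L M x → ⟦ difference L M ⟧ x ≡ ⟦ L ⟧ x - ⟦ M ⟧ x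
    ⟦difference⟧ L M x = trans (⟦++⟧ L (scale (- 1ℝ) M) x) (trans
      (cong (⟦ L ⟧ x +_) (⟦scale⟧ (- 1ℝ) M x))
      (solve 2 (λ a b → a :+ (:- :1) :* b := a :- b) refl _ _))

    ⟦restrict⟧ : ∀ t L x → ⟦ restrict t L ⟧ x ≡ coefficient t * 𝟙 (set t) x * ⟦ L ⟧ x
    ⟦restrict⟧ t []      x = solve 1 (λ a → :0 := a :* :0) refl _
    ⟦restrict⟧ t (u ∷ L) x = trans
      (cong₂ (λ i l → coefficient t * coefficient u * i + l) (𝟙-∩ (set t) (set u) x) (⟦restrict⟧ t L x))
      (solve 5 (λ a b i j l → a :* b :* (i :* j) :+ a :* i :* l := a :* i :* (b :* j :+ l)) refl _ _ _ _ _)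

    ⟦product⟧ : ∀ L M x → ⟦ product L M ⟧ x ≡ ⟦ L ⟧ x * ⟦ M ⟧ x
    ⟦product⟧ []      M x = solve 1 (λ m → :0 := :0 :* m) refl _
    ⟦product⟧ (t ∷ L) M x = begin
      ⟦ restrict t M ++ product L M ⟧ x           ≡⟨ ⟦++⟧ (restrict t M) (product L M) x ⟩
      ⟦ restrict t M ⟧ x + ⟦ product L M ⟧ x      ≡⟨ cong₂ _+_ (⟦restrict⟧ t M x) (⟦product⟧ L M x) ⟩
      coefficient t * 𝟙 (set t) x * ⟦ M ⟧ x + ⟦ L ⟧ x * ⟦ M ⟧ x
        ≡⟨ solve 3 (λ a l m → a :* m :+ l :* m := (a :+ l) :* m) refl _ _ _ ⟩
      (coefficient t * 𝟙 (set t) x + ⟦ L ⟧ x) * ⟦ M ⟧ x ∎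
      where open ≡-Reasoning

    bounded : ∀ L → ∃[ K ] 0ℝ ≤ K × ∀ x → ⟦ L ⟧ x ≤ K
    bounded []      = 0ℝ , ≤-refl , λ _ → ≤-refl
    bounded (t ∷ L) with bounded L
    ... | K , 0≤K , L≤K = ∣ c ∣ + K , 0≤∣a∣ c ⊕ 0≤K , λ x → +-mono-≤ (c𝟙≤∣c∣ (dec (set t x))) (L≤K x)
      where
      c = coefficient t

      c𝟙≤∣c∣ : ∀ {P} (d : Dec P) → c * indicator d ≤ ∣ c ∣
      c𝟙≤∣c∣ (yes _) = ≤-trans (≤-reflexive (solve 1 (λ c → c :* :1 := c) refl c)) (a≤∣a∣ c)
      c𝟙≤∣c∣ (no _)  = ≤-trans (≤-reflexive (solve 1 (λ c → c :* :0 := :0) refl c)) (0≤∣a∣ c)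

    -- Laws and independence of random variables speak of preimages of Borel sets, so roundings are
    -- built once on the line and transported along each variable.
    pullback : ∀ {f} → (∀ {B} → Borel B → Measurable 𝓐 (f ⊢ B)) → Elementary borel → Elementary 𝓐
    pullback mf = map λ t → term (coefficient t) (mf (measurable t))

  ⟦pullback⟧ : ∀ {A} {𝓐 : SigmaAlgebra A} {f} (mf : ∀ {B} → Borel B → Measurable 𝓐 (f ⊢ B)) S x →
               ⟦ pullback {𝓐 = 𝓐} mf S ⟧ x ≡ ⟦ S ⟧ (f x)
  ⟦pullback⟧ mf []      x = refl
  ⟦pullback⟧ {𝓐 = 𝓐} {f} mf (t ∷ S) x =
    cong (coefficient t * 𝟙 (set t) (f x) +_) (⟦pullback⟧ {𝓐 = 𝓐} mf S x)

  -- Adding up δ for each of the levels δ, 2δ, …, nδ exceeded by x rounds x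
  -- down to a multiple of δ, capped at nδ.
  stairs : ℝ → ℕ → Elementary borel
  stairs δ zero    = []
  stairs δ (suc n) = term δ (complement (ray (suc n · δ))) ∷ stairs δ n

  -- Induction on the height: the new top step contributes `δ` exactly when `x` exceeds the new
  -- level, and then `x` has exceeded all the earlier levels as well.
  stairs-spec : ∀ {δ} → 0ℝ ≤ δ → ∀ n {x} → 0ℝ ≤ x →
    (¬ x ≤ n · δ × ⟦ stairs δ n ⟧ x ≡ n · δ) ⊎
    (x ≤ n · δ × ⟦ stairs δ n ⟧ x ≤ x × x ≤ ⟦ stairs δ n ⟧ x + δ)
  stairs-spec {δ} 0≤δ zero {x} 0≤x with dec (x ≤ 0ℝ)
  ... | yes x≤0 = inj₂ (x≤0 , 0≤x , ≤-trans x≤0 (≤-refl ⊕ 0≤δ))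
  ... | no  x≰0 = inj₁ (x≰0 , refl)
  stairs-spec {δ} 0≤δ (suc n) {x} 0≤x with dec (x ≤ suc n · δ) | stairs-spec 0≤δ n 0≤x
  ... | no x≰ | inj₁ (_ , eq) = inj₁ (x≰ , trans
    (cong₂ (λ i s → δ * i + s) (𝟙-yes (∁ (_≤ suc n · δ)) x x≰) eq)
    (solve 2 (λ δ s → δ :* :1 :+ s := s :+ δ) refl δ _))
  ... | no x≰ | inj₂ (x≤nδ , _) =
    contradiction (≤-trans x≤nδ (conclude 0≤δ (solve 2 (λ δ s → δ := s :+ δ :- s) refl δ _))) x≰
  ... | yes x≤ | spec = inj₂ (x≤ , subst (λ s → s ≤ x × x ≤ s + δ) (sym flat) (within spec))
    where
    flat : ⟦ stairs δ (suc n) ⟧ x ≡ ⟦ stairs δ n ⟧ x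
    flat = trans (cong (λ i → δ * i + ⟦ stairs δ n ⟧ x) (𝟙-no (∁ (_≤ suc n · δ)) x λ x≰ → x≰ x≤))
      (solve 2 (λ δ s → δ :* :0 :+ s := s) refl δ _)

    within : _ → ⟦ stairs δ n ⟧ x ≤ x × x ≤ ⟦ stairs δ n ⟧ x + δ
    -- Here `x` lies above the old cap but not above the new level, so the value `n · δ` is within
    -- `δ` of it.
    within (inj₁ (x≰nδ , eq)) = subst (λ s → s ≤ x × x ≤ s + δ) (sym eq) (≰⇒≥ x≰nδ , x≤)
    within (inj₂ (_ , bounds)) = bounds

  stairs-≤ : ∀ {δ} → 0ℝ ≤ δ → ∀ n {x} → 0ℝ ≤ x → ⟦ stairs δ n ⟧ x ≤ x
  stairs-≤ 0≤δ n 0≤x with stairs-spec 0≤δ n 0≤x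
  ... | inj₁ (x≰nδ , eq)    = subst (_≤ _) (sym eq) (≰⇒≥ x≰nδ)
  ... | inj₂ (_ , below , _) = below

  ≤-stairs : ∀ {δ} → 0ℝ ≤ δ → ∀ n {x} → 0ℝ ≤ x →
             n · δ ≤ ⟦ stairs δ n ⟧ x ⊎ x ≤ ⟦ stairs δ n ⟧ x + δ
  ≤-stairs 0≤δ n 0≤x with stairs-spec 0≤δ n 0≤x
  ... | inj₁ (_ , eq)        = inj₁ (≤-reflexive (sym eq))
  ... | inj₂ (_ , _ , above) = inj₂ above

  0≤stairs : ∀ {δ} → 0ℝ ≤ δ → ∀ n x → 0ℝ ≤ ⟦ stairs δ n ⟧ x
  0≤stairs 0≤δ zero    x = ≤-refl
  0≤stairs {δ} 0≤δ (suc n) x = 0≤δ ⊗ 0≤indicator (dec _) ⊕ 0≤stairs 0≤δ n x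
    where
    0≤indicator : ∀ {P} (d : Dec P) → 0ℝ ≤ indicator d
    0≤indicator (yes _) = 0≤1
    0≤indicator (no _)  = ≤-refl

-- Finite additivity and the integral of elementary functions.

module ElementaryIntegral (em : ExcludedMiddle (lsuc 0ℓ)) (ℛ : RealField) (𝒮 : ProbabilitySpace ℛ) where
  open RealField ℛ
  open ProbabilitySpace 𝒮
  open Reals em ℛ
  open Measurability em ℛ
  open ElementaryFunctions em ℛ
  open IntegerCoefficients ℛ using (solve; _:=_; _:+_; _:*_; _:-_; :-_; :0; :1)

  events : SigmaAlgebra Ω
  events = record
    { Measurable = Event
    ; ≐-closed   = Event-resp
    ; U-closed   = Event-U
    ; ∁-closed   = Event-∁
    ; ⋃-closed   = Event-⋃
    }

  open SigmaAlgebra events using (∅-closed; ∪-closed)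

  private
    Event-∩ : ∀ {A B} → Event A → Event B → Event (A ∩ B)
    Event-∩ = ∩-closed events

  -- The offset two fits a pair of disjoint sets padded with empty ones, whose partial sums no
  -- longer change from index two on.
  HasSum-eventually-constant : ∀ {a s v} → HasSum a s → (∀ n → partialSum a (suc (suc n)) ≡ v) → v ≡ s
  HasSum-eventually-constant {a} {s} {v} a-sums const = ≤-antisym
    (decidable-stable (dec (v ≤ s)) λ v≰s → far (a≤∣a∣ (v - s)) (0<diff (≰⇒> v≰s)))
    (decidable-stable (dec (s ≤ v)) λ s≰v → far
      (subst (_≤ ∣ v - s ∣) (solve 2 (λ s v → :- (v :- s) := s :- v) refl s v) (-a≤∣a∣ (v - s)))
      (0<diff (≰⇒> s≰v)))
    where
    far : ∀ {ε} → ε ≤ ∣ v - s ∣ → ¬ 0ℝ < ε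
    far ε≤ 0<ε with a-sums _ 0<ε
    ... | N , near = <⇒≱ (near (suc (suc N)) (ℕ.m≤n+m N 2))
      (subst (λ z → _ ≤ ∣ z - s ∣) (sym (const N)) ε≤)

  -- A sequence of empty sets makes the constant series `p + p + ...` converge to `p`. If `p` were
  -- positive, every partial sum with at least two terms would be off by at least `p`.
  ℙ-∅ : ℙ ∅ ≡ 0ℝ
  ℙ-∅ = decidable-stable (dec _) λ p≢0 → vanishing (ℙ-nonneg ∅-closed , p≢0 ∘ sym)
    where
    p = ℙ ∅

    sums : HasSum (λ _ → p) p
    sums = subst (HasSum (λ _ → p))
      (ℙ-resp ((λ ()) , λ ()) (Event-⋃ (λ _ → ∅) λ _ → ∅-closed))
      (ℙ-⋃ (λ _ → ∅) (λ _ → ∅-closed) (λ _ _ _ ()))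

    0≤partialSum : ∀ n → 0ℝ ≤ partialSum (λ _ → p) n
    0≤partialSum zero    = ≤-refl
    0≤partialSum (suc n) = 0≤partialSum n ⊕ ℙ-nonneg ∅-closed

    vanishing : ¬ 0ℝ < p
    vanishing 0<p with sums p 0<p
    ... | N , near = <⇒≱ (near (suc (suc N)) (ℕ.m≤n+m N 2))
      (≤-trans (conclude (0≤partialSum N) (solve 2 (λ s p → s := s :+ p :+ p :- p :- p) refl _ p)) (a≤∣a∣ _))

  ℙ-disjoint : ∀ {A B} → Event A → Event B → A ⊥ B → ℙ (A ∪ B) ≡ ℙ A + ℙ B
  ℙ-disjoint {A} {B} eA eB disjoint = trans
    (sym (ℙ-resp (to , from) (Event-⋃ sets event)))
    (sym (HasSum-eventually-constant (ℙ-⋃ sets event pairwise) partial))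
    where
    sets : ℕ → Pred Ω 0ℓ
    sets 0             = A
    sets 1             = B
    sets (suc (suc _)) = ∅

    event : ∀ n → Event (sets n)
    event 0             = eA
    event 1             = eB
    event (suc (suc _)) = ∅-closed

    pairwise : ∀ m n → m ≢ n → sets m ⊥ sets n
    pairwise 0             0             m≢n _       = m≢n refl
    pairwise 0             1             _   x       = disjoint x
    pairwise 1             0             _   (b , a) = disjoint (a , b)
    pairwise 1             1             m≢n _       = m≢n refl
    pairwise _             (suc (suc _)) _   (_ , ())
    pairwise (suc (suc _)) 0             _   (() , _)
    pairwise (suc (suc _)) 1             _   (() , _)

    to : ∀ {ω} → ⋃ ℕ sets ω → (A ∪ B) ω
    to (0 , a) = inj₁ a
    to (1 , b) = inj₂ b

    from : ∀ {ω} → (A ∪ B) ω → ⋃ ℕ sets ω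
    from (inj₁ a) = 0 , a
    from (inj₂ b) = 1 , b

    partial : ∀ n → partialSum (ℙ ∘ sets) (suc (suc n)) ≡ ℙ A + ℙ B
    partial zero    = solve 2 (λ a b → :0 :+ a :+ b := a :+ b) refl _ _
    partial (suc n) = trans (cong₂ _+_ (partial n) ℙ-∅) (solve 1 (λ a → a :+ :0 := a) refl _)

  ℙ-split : ∀ {E A} → Event E → Event A → ℙ E ≡ ℙ (E ∩ A) + ℙ (E ∩ ∁ A)
  ℙ-split {E} {A} eE eA = trans
    (ℙ-resp ((λ {ω} e → split e (dec (A ω))) , [ proj₁ , proj₁ ]′) eE)
    (ℙ-disjoint (Event-∩ eE eA) (Event-∩ eE (Event-∁ eA)) λ ((_ , a) , (_ , ¬a)) → ¬a a)
    where
    split : ∀ {ω} → E ω → Dec (A ω) → ((E ∩ A) ∪ (E ∩ ∁ A)) ω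
    split e (yes a) = inj₁ (e , a)
    split e (no ¬a) = inj₂ (e , ¬a)

  ∫ : Elementary events → ℝ
  ∫ []      = 0ℝ
  ∫ (t ∷ L) = coefficient t * ℙ (set t) + ∫ L

  ∫-over : Pred Ω 0ℓ → Elementary events → ℝ
  ∫-over B []      = 0ℝ
  ∫-over B (t ∷ L) = coefficient t * ℙ (set t ∩ B) + ∫-over B L

  ∫-over-split : ∀ L {B A} → Event B → Event A → ∫-over B L ≡ ∫-over (B ∩ A) L + ∫-over (B ∩ ∁ A) L
  ∫-over-split []      eB eA = solve 0 (:0 := :0 :+ :0) refl
  ∫-over-split (t ∷ L) {B} {A} eB eA = trans
    (cong₂ (λ p l → coefficient t * p + l) pieces (∫-over-split L eB eA))
    (solve 5 (λ c p q l m → c :* (p :+ q) :+ (l :+ m) := c :* p :+ l :+ (c :* q :+ m)) refl _ _ _ _ _)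
    where
    eT = measurable t

    assoc : ∀ {C D : Pred Ω 0ℓ} → ((C ∩ B) ∩ D) ≐ (C ∩ (B ∩ D))
    assoc = (λ ((c , b) , d) → c , b , d) , λ (c , b , d) → (c , b) , d

    pieces : ℙ (set t ∩ B) ≡ ℙ (set t ∩ (B ∩ A)) + ℙ (set t ∩ (B ∩ ∁ A))
    pieces = trans (ℙ-split (Event-∩ eT eB) eA) (cong₂ _+_
      (ℙ-resp assoc (Event-∩ (Event-∩ eT eB) eA))
      (ℙ-resp assoc (Event-∩ (Event-∩ eT eB) (Event-∁ eA))))

  -- Splitting the event B along the first set of the list turns the first
  -- term into a constant, which is absorbed into k.
  ∫-over-nonneg : ∀ L k {B} → Event B → (∀ {ω} → B ω → 0ℝ ≤ k + ⟦ L ⟧ ω) → 0ℝ ≤ k * ℙ B + ∫-over B L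
  ∫-over-nonneg [] k {B} eB nonneg with dec (∃[ ω ] B ω)
  ... | yes (ω , b) = subst (0ℝ ≤_) (solve 1 (λ k → k :+ :0 := k) refl k) (nonneg b) ⊗ ℙ-nonneg eB ⊕ ≤-refl
  ... | no empty    = ≤-reflexive (sym (trans
    (cong (λ p → k * p + 0ℝ) (trans (ℙ-resp ((λ b → contradiction (_ , b) empty) , λ ()) eB) ℙ-∅))
    (solve 1 (λ k → k :* :0 :+ :0 := :0) refl k)))
  ∫-over-nonneg (t ∷ L) k {B} eB nonneg = subst (0ℝ ≤_) assemble (inside ⊕ outside)
    where
    A  = set t
    c  = coefficient t
    eA = measurable t

    inside : 0ℝ ≤ (k + c) * ℙ (B ∩ A) + ∫-over (B ∩ A) L
    inside = ∫-over-nonneg L (k + c) (Event-∩ eB eA) λ {ω} (b , a) →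
      subst (0ℝ ≤_) (trans (cong (λ i → k + (c * i + ⟦ L ⟧ ω)) (𝟙-yes A ω a))
        (solve 3 (λ k c l → k :+ (c :* :1 :+ l) := k :+ c :+ l) refl k c _)) (nonneg b)

    outside : 0ℝ ≤ k * ℙ (B ∩ ∁ A) + ∫-over (B ∩ ∁ A) L
    outside = ∫-over-nonneg L k (Event-∩ eB (Event-∁ eA)) λ {ω} (b , ¬a) →
      subst (0ℝ ≤_) (trans (cong (λ i → k + (c * i + ⟦ L ⟧ ω)) (𝟙-no A ω ¬a))
        (solve 3 (λ k c l → k :+ (c :* :0 :+ l) := k :+ l) refl k c _)) (nonneg b)

    assemble : (k + c) * ℙ (B ∩ A) + ∫-over (B ∩ A) L + (k * ℙ (B ∩ ∁ A) + ∫-over (B ∩ ∁ A) L)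
             ≡ k * ℙ B + (c * ℙ (A ∩ B) + ∫-over B L)
    assemble = begin
      (k + c) * p + l + (k * q + m)
        ≡⟨ solve 6 (λ k c p q l m → (k :+ c) :* p :+ l :+ (k :* q :+ m)
                    := k :* (p :+ q) :+ (c :* p :+ (l :+ m))) refl k c p q l m ⟩
      k * (p + q) + (c * p + (l + m))
        ≡⟨ cong₂ (λ x y → k * x + (c * p + y)) (sym (ℙ-split eB eA)) (sym (∫-over-split L eB eA)) ⟩
      k * ℙ B + (c * p + ∫-over B L)
        ≡⟨ cong (λ x → k * ℙ B + (c * x + ∫-over B L))
             (ℙ-resp ((λ (b , a) → a , b) , λ (a , b) → b , a) (Event-∩ eB eA)) ⟩
      k * ℙ B + (c * ℙ (A ∩ B) + ∫-over B L) ∎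
      where
      open ≡-Reasoning
      p = ℙ (B ∩ A)
      q = ℙ (B ∩ ∁ A)
      l = ∫-over (B ∩ A) L
      m = ∫-over (B ∩ ∁ A) L

  ∫-over-U : ∀ L → ∫-over U L ≡ ∫ L
  ∫-over-U []      = refl
  ∫-over-U (t ∷ L) = cong₂ (λ p l → coefficient t * p + l)
    (ℙ-resp (proj₁ , λ a → a , _) (Event-∩ (measurable t) Event-U)) (∫-over-U L)

  ∫-nonneg : ∀ L → (∀ ω → 0ℝ ≤ ⟦ L ⟧ ω) → 0ℝ ≤ ∫ L
  ∫-nonneg L nonneg = subst (0ℝ ≤_)
    (trans (solve 2 (λ p l → :0 :* p :+ l := l) refl _ _) (∫-over-U L))
    (∫-over-nonneg L 0ℝ Event-U λ {ω} _ →
      subst (0ℝ ≤_) (solve 1 (λ l → l := :0 :+ l) refl _) (nonneg ω))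

  ∫-++ : ∀ L M → ∫ (L ++ M) ≡ ∫ L + ∫ M
  ∫-++ []      M = solve 1 (λ m → m := :0 :+ m) refl _
  ∫-++ (t ∷ L) M = trans (cong (coefficient t * ℙ (set t) +_) (∫-++ L M))
    (solve 3 (λ h l m → h :+ (l :+ m) := h :+ l :+ m) refl _ _ _)

  ∫-constant : ∀ a → ∫ (constant a) ≡ a
  ∫-constant a = trans (cong (λ p → a * p + 0ℝ) ℙ-U) (solve 1 (λ a → a :* :1 :+ :0 := a) refl a)

  ∫-scale : ∀ a L → ∫ (scale a L) ≡ a * ∫ L
  ∫-scale a []      = solve 1 (λ a → :0 := a :* :0) refl a
  ∫-scale a (t ∷ L) = trans (cong (a * coefficient t * ℙ (set t) +_) (∫-scale a L))
    (solve 4 (λ a c p l → a :* c :* p :+ a :* l := a :* (c :* p :+ l)) refl a _ _ _)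

  ∫-difference : ∀ L M → ∫ (difference L M) ≡ ∫ L - ∫ M
  ∫-difference L M = trans (∫-++ L (scale (- 1ℝ) M)) (trans (cong (∫ L +_) (∫-scale (- 1ℝ) M))
    (solve 2 (λ a b → a :+ (:- :1) :* b := a :- b) refl _ _))

  ∫-mono : ∀ L M → (∀ ω → ⟦ L ⟧ ω ≤ ⟦ M ⟧ ω) → ∫ L ≤ ∫ M
  ∫-mono L M L≤M = conclude
    (∫-nonneg (difference M L) λ ω → subst (0ℝ ≤_) (sym (⟦difference⟧ M L ω)) (0≤diff (L≤M ω)))
    (∫-difference M L)

  -- The integral is thereby independent of the expression; monotonicity in both directions takes
  -- the place of a common refinement.
  ∫-cong : ∀ L M → (∀ ω → ⟦ L ⟧ ω ≡ ⟦ M ⟧ ω) → ∫ L ≡ ∫ M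
  ∫-cong L M eq = ≤-antisym
    (∫-mono L M λ ω → ≤-reflexive (eq ω)) (∫-mono M L λ ω → ≤-reflexive (sym (eq ω)))

  module FromSimple {s} (simple : IsSimple s) where
    open IsSimple simple

    level : ℝ → Pred Ω 0ℓ
    level c ω = s ω ≡ c

    LevelEvents : List ℝ → Set₁
    LevelEvents vs = ∀ {c} → c ∈ vs → Event (level c)

    levels : ∀ vs → LevelEvents vs → Elementary events
    levels []       _ = []
    levels (c ∷ vs) e = term c (e (here refl)) ∷ levels vs (e ∘ there)

    ∫-levels : ∀ vs (e : LevelEvents vs) → ∫ (levels vs e) ≡ sum (map (λ c → c * ℙ (level c)) vs)
    ∫-levels []       e = refl
    ∫-levels (c ∷ vs) e = cong (c * ℙ _ +_) (∫-levels vs (e ∘ there))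

    ⟦levels⟧-∉ : ∀ vs (e : LevelEvents vs) ω → s ω ∉ vs → ⟦ levels vs e ⟧ ω ≡ 0ℝ
    ⟦levels⟧-∉ []       e ω _     = refl
    ⟦levels⟧-∉ (c ∷ vs) e ω sω∉ = trans
      (cong₂ (λ i l → c * i + l) (𝟙-no (level c) ω (sω∉ ∘ here)) (⟦levels⟧-∉ vs (e ∘ there) ω (sω∉ ∘ there)))
      (solve 1 (λ c → c :* :0 :+ :0 := :0) refl c)

    -- Uniqueness of the listed values ensures that only one level set contains `ω`.
    ⟦levels⟧-∈ : ∀ vs (e : LevelEvents vs) ω → Unique vs → s ω ∈ vs → ⟦ levels vs e ⟧ ω ≡ s ω
    ⟦levels⟧-∈ (c ∷ vs) e ω (fresh ∷ _) (here sω≡c) = trans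
      (cong₂ (λ i l → c * i + l) (𝟙-yes (level c) ω sω≡c)
        (⟦levels⟧-∉ vs (e ∘ there) ω λ sω∈ → All.lookup fresh sω∈ (sym sω≡c)))
      (trans (solve 1 (λ c → c :* :1 :+ :0 := c) refl c) (sym sω≡c))
    ⟦levels⟧-∈ (c ∷ vs) e ω (fresh ∷ unique′) (there sω∈) = trans
      (cong₂ (λ i l → c * i + l) (𝟙-no (level c) ω λ sω≡c → All.lookup fresh sω∈ (sym sω≡c))
        (⟦levels⟧-∈ vs (e ∘ there) ω unique′ sω∈))
      (solve 2 (λ c s → c :* :0 :+ s := s) refl c _)

    elementary : Elementary events
    elementary = levels values level-set

    ⟦elementary⟧ : ∀ ω → ⟦ elementary ⟧ ω ≡ s ω
    ⟦elementary⟧ ω = ⟦levels⟧-∈ values level-set ω unique (attained ω)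

    ∫-elementary : ∫ elementary ≡ integral
    ∫-elementary = ∫-levels values level-set

  -- All sums of subsets of the coefficients, including sums that may never be attained. The factors
  -- `1ℝ` and `0ℝ` are kept so that the entries agree with `⟦_⟧` by computation.
  candidates : Elementary events → List ℝ
  candidates []      = 0ℝ ∷ []
  candidates (t ∷ L) =
    map (coefficient t * 1ℝ +_) (candidates L) ++ map (coefficient t * 0ℝ +_) (candidates L)

  ⟦⟧∈candidates : ∀ L ω → ⟦ L ⟧ ω ∈ candidates L
  ⟦⟧∈candidates []      ω = here refl
  ⟦⟧∈candidates (t ∷ L) ω with dec (set t ω)
  ... | yes _ = ∈-++⁺ˡ (∈-map⁺ (coefficient t * 1ℝ +_) (⟦⟧∈candidates L ω))
  ... | no _  = ∈-++⁺ʳ (map (coefficient t * 1ℝ +_) (candidates L)) (∈-map⁺ (coefficient t * 0ℝ +_) (⟦⟧∈candidates L ω))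

  -- Once it is known whether `ω` lies in the first set, the rest of the list must take the value
  -- that remains after subtracting the first term.
  level-event : ∀ (L : Elementary events) v → Event (λ ω → ⟦ L ⟧ ω ≡ v)
  level-event [] v with dec (0ℝ ≡ v)
  ... | yes 0≡v = Event-resp ((λ _ → 0≡v) , λ _ → _) Event-U
  ... | no 0≢v  = Event-resp ((λ ()) , λ 0≡v → 0≢v 0≡v) ∅-closed
  level-event (t ∷ L) v = Event-resp (to , λ {ω} → from ω)
    (∪-closed (Event-∩ (measurable t) (level-event L (v - c * 1ℝ)))
              (Event-∩ (Event-∁ (measurable t)) (level-event L (v - c * 0ℝ))))
    where
    c = coefficient t

    move : ∀ {a b} → a + b ≡ v → b ≡ v - a
    move {a} {b} refl = solve 2 (λ a b → b := a :+ b :- a) refl a b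

    unmove : ∀ {a b} → b ≡ v - a → a + b ≡ v
    unmove {a} refl = solve 2 (λ a v → a :+ (v :- a) := v) refl a v

    to : ∀ {ω} → ((set t ∩ λ ω → ⟦ L ⟧ ω ≡ v - c * 1ℝ) ∪ (∁ (set t) ∩ λ ω → ⟦ L ⟧ ω ≡ v - c * 0ℝ)) ω →
         c * 𝟙 (set t) ω + ⟦ L ⟧ ω ≡ v
    to {ω} (inj₁ (a , eq))  = trans (cong (λ i → c * i + ⟦ L ⟧ ω) (𝟙-yes (set t) ω a)) (unmove eq)
    to {ω} (inj₂ (¬a , eq)) = trans (cong (λ i → c * i + ⟦ L ⟧ ω) (𝟙-no (set t) ω ¬a)) (unmove eq)

    from : ∀ ω → c * 𝟙 (set t) ω + ⟦ L ⟧ ω ≡ v →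
           ((set t ∩ λ ω → ⟦ L ⟧ ω ≡ v - c * 1ℝ) ∪ (∁ (set t) ∩ λ ω → ⟦ L ⟧ ω ≡ v - c * 0ℝ)) ω
    from ω eq with dec (set t ω)
    ... | yes a = inj₁ (a , move eq)
    ... | no ¬a = inj₂ (¬a , move eq)

  isSimple : ∀ (L : Elementary events) → IsSimple ⟦ L ⟧
  isSimple L = record
    { values    = deduplicate _≟_ (candidates L)
    ; unique    = deduplicate-! _≟_ (candidates L)
    ; attained  = λ ω → ∈-deduplicate⁺ _≟_ (⟦⟧∈candidates L ω)
    ; level-set = λ {v} _ → level-event L v
    }
    where
    _≟_ : ∀ x y → Dec (x ≡ y)
    x ≟ y = dec (x ≡ y)

  -- The level sets of `⟦ L ⟧` give a second expression for the same function.
  integral-isSimple : ∀ L → IsSimple.integral (isSimple L) ≡ ∫ L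
  integral-isSimple L = trans (sym ∫-elementary) (∫-cong elementary L ⟦elementary⟧)
    where open FromSimple (isSimple L)

-- Upper estimates for the Lebesgue integral and the existence of expectations.

module Integral (em : ExcludedMiddle (lsuc 0ℓ)) (ℛ : RealField) (𝒮 : ProbabilitySpace ℛ) where
  open RealField ℛ
  open ProbabilitySpace 𝒮
  open Reals em ℛ
  open Measurability em ℛ
  open ElementaryFunctions em ℛ
  open ElementaryIntegral em ℛ 𝒮
  open IntegerCoefficients ℛ using (solve; _:=_; _:+_; _:*_; _:-_; :-_; :0; :1)

  -- Unlike in LowerIntegral, the elementary functions below f may be negative,
  -- which leaves room for subtracting from them.
  Bounds : (Ω → ℝ) → ℝ → Set₁
  Bounds f v = ∀ L → (∀ ω → ⟦ L ⟧ ω ≤ f ω) → ∫ L ≤ v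

  Bounds-anti : ∀ {f g : Ω → ℝ} {v} → (∀ ω → f ω ≤ g ω) → Bounds g v → Bounds f v
  Bounds-anti f≤g bound L L≤f = bound L λ ω → ≤-trans (L≤f ω) (f≤g ω)

  Bounds-shift : ∀ {f v} k → Bounds f v → Bounds (λ ω → f ω + k) (v + k)
  Bounds-shift {f} {v} k bound L L≤f+k = conclude
    (0≤diff (bound (difference L (constant k)) λ ω → conclude (0≤diff (L≤f+k ω)) (begin
      f ω + k - ⟦ L ⟧ ω
        ≡⟨ solve 3 (λ f k l → f :+ k :- l := f :- (l :- k)) refl (f ω) k (⟦ L ⟧ ω) ⟩
      f ω - (⟦ L ⟧ ω - k)
        ≡⟨ cong (λ z → f ω - (⟦ L ⟧ ω - z)) (⟦constant⟧ {𝓐 = events} k ω) ⟨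
      f ω - (⟦ L ⟧ ω - ⟦ constant {𝓐 = events} k ⟧ ω)
        ≡⟨ cong (λ z → f ω - z) (⟦difference⟧ L (constant k) ω) ⟨
      f ω - ⟦ difference L (constant k) ⟧ ω ∎)))
    (begin
      v - ∫ (difference L (constant k))  ≡⟨ cong (λ z → v - z) (∫-difference L (constant k)) ⟩
      v - (∫ L - ∫ (constant k))         ≡⟨ cong (λ z → v - (∫ L - z)) (∫-constant k) ⟩
      v - (∫ L - k)                      ≡⟨ solve 3 (λ v k l → v :- (l :- k) := v :+ k :- l) refl v k (∫ L) ⟩
      v + k - ∫ L                        ∎)
    where open ≡-Reasoning

  integral-≥ : ∀ {f v} → HasIntegral⁺ f v → ∀ L → (∀ ω → 0ℝ ≤ ⟦ L ⟧ ω) → (∀ ω → ⟦ L ⟧ ω ≤ f ω) → ∫ L ≤ v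
  integral-≥ {v = v} (upper , _) L 0≤L L≤f = subst (_≤ v) (integral-isSimple L)
    (upper _ (⟦ L ⟧ , isSimple L , (λ ω → 0≤L ω , L≤f ω) , refl))

  lower-integral-≤ : ∀ {f b} → Bounds f b → IsUpperBound (LowerIntegral f) b
  lower-integral-≤ {f} {b} bound _ (s , simple , s-between , refl) = subst (_≤ b) ∫-elementary
    (bound elementary λ ω → subst (_≤ f ω) (sym (⟦elementary⟧ ω)) (proj₂ (s-between ω)))
    where open FromSimple simple

  zero-below : ∀ {f} → (∀ ω → 0ℝ ≤ f ω) → LowerIntegral f (IsSimple.integral (isSimple []))
  zero-below 0≤f = ⟦ [] {A = Term events} ⟧ , isSimple [] , (λ ω → ≤-refl , 0≤f ω) , refl

  -- Completeness speaks about predicates in Set, hence the truncation of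
  -- LowerIntegral f through its decision.
  integral-exists : ∀ {f b} → (∀ ω → 0ℝ ≤ f ω) → Bounds f b → ∃[ v ] HasIntegral⁺ f v
  integral-exists {f} {b} 0≤f bound =
    proj₁ sup , (λ x x∈ → proj₁ (proj₂ sup) x (fromWitness x∈)) ,
    λ c upper → proj₂ (proj₂ sup) c λ x x∈ → upper x (toWitness x∈)
    where
    Lower : ℝ → Set
    Lower v = True (em {LowerIntegral f v})

    sup : ∃[ s ] IsSupremum Lower s
    sup = complete Lower (_ , fromWitness (zero-below 0≤f))
      (b , λ x x∈ → lower-integral-≤ bound x (toWitness x∈))

  0≤⊔0 : ∀ x → 0ℝ ≤ x ⊔ 0ℝ
  0≤⊔0 x = x≤y⊔x x 0ℝ

  integral-zero : ∀ {f : Ω → ℝ} → (∀ ω → 0ℝ ≤ f ω) → HasIntegral⁺ (λ ω → (- f ω) ⊔ 0ℝ) 0ℝ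
  integral-zero {f} 0≤f =
    lower-integral-≤ (λ L L≤0 → ∫-mono L [] λ ω → ≤-trans (L≤0 ω) (⊔-lub (-f≤0 ω) ≤-refl)) ,
    λ b upper → subst (_≤ b) (integral-isSimple []) (upper _ (zero-below λ ω → 0≤⊔0 (- f ω)))
    where
    -f≤0 : ∀ ω → - f ω ≤ 0ℝ
    -f≤0 ω = conclude (0≤f ω) (solve 1 (λ a → a := :0 :- (:- a)) refl (f ω))

  -- Since L is bounded, g only needs to be rounded correctly below some height.
  round-down : ∀ {g} → IsRandomVariable g → (∀ ω → 0ℝ ≤ g ω) → ∀ {δ} → 0ℝ < δ → ∀ (L : Elementary events) →
    Σ[ G ∈ Elementary events ] (∀ ω → 0ℝ ≤ ⟦ G ⟧ ω) × (∀ ω → ⟦ G ⟧ ω ≤ g ω) ×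
      (∀ ω {a} → 0ℝ ≤ a → ⟦ L ⟧ ω ≤ a + g ω → ⟦ L ⟧ ω ≤ a + (⟦ G ⟧ ω + δ))
  round-down {g} rv 0≤g {δ} 0<δ L = G ,
    (λ ω → subst (0ℝ ≤_) (sym (G≡ ω)) (0≤stairs (proj₁ 0<δ) n (g ω))) ,
    (λ ω → subst (_≤ g ω) (sym (G≡ ω)) (stairs-≤ (proj₁ 0<δ) n (0≤g ω))) ,
    λ ω 0≤a L≤a+g → subst (λ z → ⟦ L ⟧ ω ≤ _ + (z + δ)) (sym (G≡ ω))
      (dominate 0≤a L≤a+g (≤-stairs (proj₁ 0<δ) n (0≤g ω)))
    where
    K = proj₁ (bounded L)
    n = proj₁ (archimedean 0<δ K)
    G = pullback {𝓐 = events} rv (stairs δ n)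

    G≡ : ∀ ω → ⟦ G ⟧ ω ≡ ⟦ stairs δ n ⟧ (g ω)
    G≡ = ⟦pullback⟧ {𝓐 = events} rv (stairs δ n)

    dominate : ∀ {ω a r} → 0ℝ ≤ a → ⟦ L ⟧ ω ≤ a + g ω → n · δ ≤ r ⊎ g ω ≤ r + δ → ⟦ L ⟧ ω ≤ a + (r + δ)
    dominate {ω} {a} {r} 0≤a L≤a+g (inj₁ nδ≤r) = ≤-trans (proj₂ (proj₂ (bounded L)) ω)
      (≤-trans (proj₂ (archimedean 0<δ K)) (conclude (0≤a ⊕ 0≤diff nδ≤r ⊕ proj₁ 0<δ)
        (solve 4 (λ a r δ m → a :+ (r :- m) :+ δ := a :+ (r :+ δ) :- m) refl a r δ (n · δ))))
    dominate 0≤a L≤a+g (inj₂ g≤r+δ) = ≤-trans L≤a+g (+-mono-≤ ≤-refl g≤r+δ)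

  private
    ∫-+δ : ∀ G δ → ∫ (G ++ constant δ) ≡ ∫ G + δ
    ∫-+δ G δ = trans (∫-++ G (constant δ)) (cong (∫ G +_) (∫-constant δ))

    ⟦+δ⟧ : ∀ (G : Elementary events) δ ω → ⟦ G ++ constant δ ⟧ ω ≡ ⟦ G ⟧ ω + δ
    ⟦+δ⟧ G δ ω = trans (⟦++⟧ G (constant δ) ω) (cong (⟦ G ⟧ ω +_) (⟦constant⟧ {𝓐 = events} δ ω))

  -- The supremum controls only nonnegative simple functions, while `L` may be negative in places.
  -- The rounding `G` of `g` is nonnegative and below `g`, and `G + δ` dominates `L`; hence
  -- `∫ L ≤ v + δ`.
  integral⇒Bounds : ∀ {g v} → IsRandomVariable g → (∀ ω → 0ℝ ≤ g ω) → HasIntegral⁺ g v → Bounds g v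
  integral⇒Bounds {g} {v} rv 0≤g hasIntegral L L≤g = ≤-approx 0≤1 λ δ 0<δ _ →
    let G , 0≤G , G≤g , dominate = round-down rv 0≤g 0<δ L in
    ≤-trans
      (∫-mono L (G ++ constant δ) λ ω → subst (⟦ L ⟧ ω ≤_)
        (trans (solve 2 (λ x δ → :0 :+ (x :+ δ) := x :+ δ) refl (⟦ G ⟧ ω) δ) (sym (⟦+δ⟧ G δ ω)))
        (dominate ω ≤-refl (subst (⟦ L ⟧ ω ≤_) (solve 1 (λ x → x := :0 :+ x) refl (g ω)) (L≤g ω))))
      (conclude (0≤diff (integral-≥ hasIntegral G 0≤G G≤g)) (trans
        (solve 3 (λ v x δ → v :- x := v :+ δ :* :1 :- (x :+ δ)) refl v (∫ G) δ)
        (cong (λ z → v + δ * 1ℝ - z) (sym (∫-+δ G δ)))))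

  -- Rounding `g` down to `G` splits `L` into two elementary pieces: `L - (G + δ)` lies below `f`,
  -- and `G` lies below `g`. The first piece may well be negative.
  Bounds-+ : ∀ {f g v w} → (∀ ω → 0ℝ ≤ f ω) → Bounds f v →
             IsRandomVariable g → (∀ ω → 0ℝ ≤ g ω) → Bounds g w →
             Bounds (λ ω → f ω + g ω) (v + w)
  Bounds-+ {f} {g} {v} {w} 0≤f f-bound rv 0≤g g-bound L L≤f+g = ≤-approx 0≤1 λ δ 0<δ _ →
    let G , _ , G≤g , dominate = round-down rv 0≤g 0<δ L
        G+δ = G ++ constant δ
    in conclude
      (0≤diff (f-bound (difference L G+δ) λ ω → conclude (0≤diff (dominate ω (0≤f ω) (L≤f+g ω)))
          (trans (solve 4 (λ f x δ l → f :+ (x :+ δ) :- l := f :- (l :- (x :+ δ))) refl (f ω) (⟦ G ⟧ ω) δ (⟦ L ⟧ ω))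
          (cong (λ z → f ω - z) (sym (trans (⟦difference⟧ L G+δ ω) (cong (λ z → ⟦ L ⟧ ω - z) (⟦+δ⟧ G δ ω)))))))
        ⊕ 0≤diff (g-bound G G≤g))
      (trans
        (cong (λ z → v - z + (w - ∫ G)) (trans (∫-difference L G+δ) (cong (λ z → ∫ L - z) (∫-+δ G δ))))
        (solve 5 (λ v w l x δ → v :- (l :- (x :+ δ)) :+ (w :- x) := v :+ w :+ δ :* :1 :- l) refl v w (∫ L) (∫ G) δ))

  ∘-isRandomVariable : ∀ {X h} → IsRandomVariable X → SublevelMeasurable borel h → IsRandomVariable (h ∘ X)
  ∘-isRandomVariable rv mh b = rv (preimage-measurable borel mh b)

  ⊔0-measurable : SublevelMeasurable borel (_⊔ 0ℝ)
  ⊔0-measurable = valley⇒Borel 0ℝ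
    (λ {x} {y} _ x≤y → ⊔-lub (≤-trans x≤y (x≤x⊔y y 0ℝ)) (0≤⊔0 y))
    (λ {x} {y} y≤0 _ → ⊔-lub (≤-trans y≤0 (0≤⊔0 x)) (0≤⊔0 x))

  -⊔0-measurable : SublevelMeasurable borel (λ x → (- x) ⊔ 0ℝ)
  -⊔0-measurable = valley⇒Borel 0ℝ
    (λ {x} {y} 0≤x x≤y → ⊔-lub (≤-trans (-≤0 0≤x) (0≤⊔0 (- y))) (0≤⊔0 (- y)))
    (λ {x} {y} _ x≤y → ⊔-lub (≤-trans (neg-anti x≤y) (x≤x⊔y (- x) 0ℝ)) (0≤⊔0 (- x)))
    where
    neg-anti : ∀ {x y} → x ≤ y → - y ≤ - x
    neg-anti {x} {y} x≤y = conclude (0≤diff x≤y) (solve 2 (λ x y → y :- x := :- x :- (:- y)) refl x y)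

    -≤0 : ∀ {x} → 0ℝ ≤ x → - x ≤ 0ℝ
    -≤0 {x} 0≤x = conclude 0≤x (solve 1 (λ x → x := :0 :- (:- x)) refl x)

  module _ {X} (int : Integrable X) where
    open Integrable int

    positive-part-isRandomVariable : IsRandomVariable (λ ω → X ω ⊔ 0ℝ)
    positive-part-isRandomVariable = ∘-isRandomVariable isRandomVariable ⊔0-measurable

    negative-part-isRandomVariable : IsRandomVariable (λ ω → (- X ω) ⊔ 0ℝ)
    negative-part-isRandomVariable = ∘-isRandomVariable isRandomVariable -⊔0-measurable

    positive-part-Bounds : Bounds (λ ω → X ω ⊔ 0ℝ) 𝔼⁺
    positive-part-Bounds = integral⇒Bounds positive-part-isRandomVariable (λ ω → 0≤⊔0 (X ω)) positive-part

    negative-part-Bounds : Bounds (λ ω → (- X ω) ⊔ 0ℝ) 𝔼⁻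
    negative-part-Bounds = integral⇒Bounds negative-part-isRandomVariable (λ ω → 0≤⊔0 (- X ω)) negative-part

  integrable : ∀ {X a b} → IsRandomVariable X →
               Bounds (λ ω → X ω ⊔ 0ℝ) a → Bounds (λ ω → (- X ω) ⊔ 0ℝ) b → Integrable X
  integrable {X} rv bound⁺ bound⁻ =
    let v , v-integral = integral-exists (λ ω → 0≤⊔0 (X ω)) bound⁺
        w , w-integral = integral-exists (λ ω → 0≤⊔0 (- X ω)) bound⁻
    in record { isRandomVariable = rv ; 𝔼⁺ = v ; 𝔼⁻ = w ; positive-part = v-integral ; negative-part = w-integral }

  -- The expectation is characterised as the least `v` with `Bounds f v`; the first half lets it
  -- serve as a hypothesis of further estimates, the second turns an estimate into an inequality of
  -- expectations.
  nonneg-integrable : ∀ {f b} → IsRandomVariable f → (∀ ω → 0ℝ ≤ f ω) → Bounds f b →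
    Σ[ int ∈ Integrable f ] Bounds f (𝔼 f int) × (∀ c → Bounds f c → 𝔼 f int ≤ c)
  nonneg-integrable {f} rv 0≤f bound =
    int ,
    subst (Bounds f) (sym 𝔼≡) (Bounds-anti (λ ω → x≤x⊔y (f ω) 0ℝ) (positive-part-Bounds int)) ,
    λ c c-bound → subst (_≤ c) (sym 𝔼≡) (proj₂ v-integral c (lower-integral-≤ (Bounds-anti f⊔0≤f c-bound)))
    where
    f⊔0≤f : ∀ ω → f ω ⊔ 0ℝ ≤ f ω
    f⊔0≤f ω = ⊔-lub ≤-refl (0≤f ω)

    existence  = integral-exists (λ ω → 0≤⊔0 (f ω)) (Bounds-anti f⊔0≤f bound)
    v          = proj₁ existence
    v-integral = proj₂ existence

    int : Integrable f
    int = record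
      { isRandomVariable = rv
      ; 𝔼⁺               = v
      ; 𝔼⁻               = 0ℝ
      ; positive-part    = v-integral
      ; negative-part    = integral-zero 0≤f
      }

    𝔼≡ : 𝔼 f int ≡ v
    𝔼≡ = solve 1 (λ v → v :- :0 := v) refl v

-- Independence and the second moment bound.

module Independence (em : ExcludedMiddle (lsuc 0ℓ)) (ℛ : RealField) (𝒮 : ProbabilitySpace ℛ) where
  open RealField ℛ
  open ProbabilitySpace 𝒮
  open Reals em ℛ
  open Measurability em ℛ
  open ElementaryFunctions em ℛ
  open ElementaryIntegral em ℛ 𝒮
  open Integral em ℛ 𝒮
  open IntegerCoefficients ℛ using (solve; _:=_; _:+_; _:*_; _:-_; :0; :1)

  Independent₂ : (X X′ : Ω → ℝ) → Set₁
  Independent₂ X X′ = ∀ {B B′} → Borel B → Borel B′ →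
    ℙ ((X ⊢ B) ∩ (X′ ⊢ B′)) ≡ ℙ (X ⊢ B) * ℙ (X′ ⊢ B′)

  module _ {X X′} (rv : IsRandomVariable X) (rv′ : IsRandomVariable X′) where

    private
      pull : Elementary borel → Elementary events
      pull = pullback {𝓐 = events} rv

      pull′ : Elementary borel → Elementary events
      pull′ = pullback {𝓐 = events} rv′

    ∫-identical : IdenticallyDistributed X X′ → ∀ S → ∫ (pull S) ≡ ∫ (pull′ S)
    ∫-identical identical []      = refl
    ∫-identical identical (t ∷ S) =
      cong₂ (λ p s → coefficient t * p + s) (identical {set t} (measurable t)) (∫-identical identical S)

    module _ (independent : Independent₂ X X′) where

      ∫-restrict-independent : ∀ (t : Term borel) T →
        ∫ (restrict (term (coefficient t) (rv {set t} (measurable t))) (pull′ T)) ≡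
        coefficient t * ℙ (X ⊢ set t) * ∫ (pull′ T)
      ∫-restrict-independent t []      = solve 1 (λ a → :0 := a :* :0) refl _
      ∫-restrict-independent t (u ∷ T) = trans
        (cong₂ (λ p l → coefficient t * coefficient u * p + l)
          (independent {set t} {set u} (measurable t) (measurable u)) (∫-restrict-independent t T))
        (solve 5 (λ a b p q l → a :* b :* (p :* q) :+ a :* p :* l := a :* p :* (b :* q :+ l)) refl
          (coefficient t) (coefficient u) _ _ _)

      -- Both sides are bilinear in the terms, and for one pair of terms the claim is independence
      -- of two preimages.
      ∫-product-independent : ∀ S T → ∫ (product (pull S) (pull′ T)) ≡ ∫ (pull S) * ∫ (pull′ T)
      ∫-product-independent []      T = solve 1 (λ m → :0 := :0 :* m) refl _
      ∫-product-independent (t ∷ S) T = trans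
        (∫-++ (restrict (term (coefficient t) (rv {set t} (measurable t))) (pull′ T)) (product (pull S) (pull′ T)))
        (trans (cong₂ _+_ (∫-restrict-independent t T) (∫-product-independent S T))
          (solve 3 (λ a l m → a :* m :+ l :* m := (a :+ l) :* m) refl _ _ _))

  TwoOf : Pred ℝ 0ℓ → ℝ → ℝ → ℝ → Set
  TwoOf P x y z = (P x × P y) ⊎ (P y × P z) ⊎ (P x × P z)

  -- A function `S` on the line is chosen with `min(x, nδ) ≤ S x ≤ x + δ` for `x ≥ 0`. The lower
  -- bound puts `L` below the sum of the three products of the `S ∘ Aᵢ`, whose integral is `3 e²`;
  -- the upper bound gives `e ≤ D + δ`.
  second-moment-bound : ∀ {A₁ A₂ A₃ R : Ω → ℝ} {D} →
    IsRandomVariable A₁ → IsRandomVariable A₂ → IsRandomVariable A₃ →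
    IdenticallyDistributed A₁ A₂ → IdenticallyDistributed A₁ A₃ →
    Independent₂ A₁ A₂ → Independent₂ A₂ A₃ → Independent₂ A₁ A₃ →
    (∀ ω → 0ℝ ≤ A₁ ω) → (∀ ω → 0ℝ ≤ A₂ ω) → (∀ ω → 0ℝ ≤ A₃ ω) → (∀ ω → 0ℝ ≤ R ω) →
    (∀ ω → TwoOf (R ω ≤_) (A₁ ω) (A₂ ω) (A₃ ω)) →
    Bounds A₁ D → Bounds (λ ω → R ω ²) (3ℝ * D ²)
  second-moment-bound {A₁} {A₂} {A₃} {R} {D} rv₁ rv₂ rv₃ id₁₂ id₁₃ ind₁₂ ind₂₃ ind₁₃
    0≤A₁ 0≤A₂ 0≤A₃ 0≤R two bound L L≤R² = ≤-approx ((0≤3 ⊕ 0≤3) ⊗ 0≤D ⊕ 0≤3) approx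
    where
    0≤D : 0ℝ ≤ D
    -- The empty expression denotes zero, which lies below `A₁`.
    0≤D = bound [] 0≤A₁

    0≤3 : 0ℝ ≤ 3ℝ
    0≤3 = 0≤1 ⊕ 0≤1 ⊕ 0≤1

    K   = proj₁ (bounded L)
    0≤K = proj₁ (proj₂ (bounded L))
    L≤K = proj₂ (proj₂ (bounded L))

    module Approximation (δ : ℝ) (0<δ : 0ℝ < δ) where
      0≤δ = proj₁ 0<δ

      n : ℕ
      -- The square of the cap has to reach `K`, the upper bound of `L`; a cap of at least `K + 1`
      -- does so even when `K` is below 1.
      n = proj₁ (archimedean 0<δ (K + 1ℝ))

      K+1≤nδ : K + 1ℝ ≤ n · δ
      K+1≤nδ = proj₂ (archimedean 0<δ (K + 1ℝ))

      S : Elementary borel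
      -- The extra `δ` on the whole line turns rounding down into rounding up, below the cap.
      S = term δ Borel-U ∷ stairs δ n

      ⟦S⟧ : ∀ x → ⟦ S ⟧ x ≡ ⟦ stairs δ n ⟧ x + δ
      ⟦S⟧ x = trans (cong (λ i → δ * i + ⟦ stairs δ n ⟧ x) (𝟙-yes U x _))
        (solve 2 (λ δ s → δ :* :1 :+ s := s :+ δ) refl δ _)

      0≤S : ∀ x → 0ℝ ≤ ⟦ S ⟧ x
      0≤S x = subst (0ℝ ≤_) (sym (⟦S⟧ x)) (0≤stairs 0≤δ n x ⊕ 0≤δ)

      S≤ : ∀ {x} → 0ℝ ≤ x → ⟦ S ⟧ x ≤ x + δ
      S≤ {x} 0≤x = subst (_≤ x + δ) (sym (⟦S⟧ x)) (+-mono-≤ (stairs-≤ 0≤δ n 0≤x) ≤-refl)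

      ≤S : ∀ {m x} → m ≤ n · δ → m ≤ x → 0ℝ ≤ x → m ≤ ⟦ S ⟧ x
      ≤S {m} {x} m≤nδ m≤x 0≤x = subst (m ≤_) (sym (⟦S⟧ x)) (case (≤-stairs 0≤δ n 0≤x))
        where
        case : n · δ ≤ ⟦ stairs δ n ⟧ x ⊎ x ≤ ⟦ stairs δ n ⟧ x + δ → m ≤ ⟦ stairs δ n ⟧ x + δ
        case (inj₁ nδ≤) = ≤-trans m≤nδ (≤-trans nδ≤ (conclude 0≤δ (solve 2 (λ s δ → δ := s :+ δ :- s) refl _ δ)))
        case (inj₂ x≤)  = ≤-trans m≤x x≤

      -- Stairs capped at nδ need not reach R, but they reach a height m whose
      -- square still dominates L.
      capped : ∀ ω → ∃[ m ] 0ℝ ≤ m × m ≤ n · δ × m ≤ R ω × ⟦ L ⟧ ω ≤ m * m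
      capped ω with total (R ω) (n · δ)
      ... | inj₁ R≤nδ = R ω , 0≤R ω , R≤nδ , ≤-refl , L≤R² ω
      ... | inj₂ nδ≤R = n · δ , ·-nonneg n 0≤δ , ≤-refl , nδ≤R , ≤-trans (L≤K ω) (conclude
        (0≤diff (*-mono-≤ (0≤K ⊕ 0≤1) (0≤K ⊕ 0≤1) K+1≤nδ K+1≤nδ) ⊕ (0≤K ⊗ 0≤K ⊕ 0≤K ⊕ 0≤1))
        (solve 2 (λ k c → c :* c :- (k :+ :1) :* (k :+ :1) :+ (k :* k :+ k :+ :1) := c :* c :- k) refl K (n · δ)))

      G₁ = pullback {𝓐 = events} rv₁ S
      G₂ = pullback {𝓐 = events} rv₂ S
      G₃ = pullback {𝓐 = events} rv₃ S

      products : Elementary events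
      products = product G₁ G₂ ++ (product G₂ G₃ ++ product G₁ G₃)

      pairs : ℝ → ℝ → ℝ → ℝ
      pairs x y z = x * y + (y * z + x * z)

      ⟦products⟧ : ∀ ω → ⟦ products ⟧ ω ≡ pairs (⟦ S ⟧ (A₁ ω)) (⟦ S ⟧ (A₂ ω)) (⟦ S ⟧ (A₃ ω))
      ⟦products⟧ ω = trans (⟦++⟧ (product G₁ G₂) _ ω) (cong₂ _+_ (pair rv₁ rv₂)
        (trans (⟦++⟧ (product G₂ G₃) _ ω) (cong₂ _+_ (pair rv₂ rv₃) (pair rv₁ rv₃))))
        where
        pair : ∀ {X X′} (rv : IsRandomVariable X) (rv′ : IsRandomVariable X′) →
          ⟦ product (pullback {𝓐 = events} rv S) (pullback {𝓐 = events} rv′ S) ⟧ ω ≡ ⟦ S ⟧ (X ω) * ⟦ S ⟧ (X′ ω)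
        pair rv rv′ = trans (⟦product⟧ (pullback {𝓐 = events} rv S) (pullback {𝓐 = events} rv′ S) ω)
          (cong₂ _*_ (⟦pullback⟧ {𝓐 = events} rv S ω) (⟦pullback⟧ {𝓐 = events} rv′ S ω))

      L≤products : ∀ ω → ⟦ L ⟧ ω ≤ ⟦ products ⟧ ω
      L≤products ω with capped ω
      ... | m , 0≤m , m≤nδ , m≤R , L≤m² =
        ≤-trans L≤m² (subst (m * m ≤_) (sym (⟦products⟧ ω)) (case (two ω)))
        where
        s₁ = ⟦ S ⟧ (A₁ ω)
        s₂ = ⟦ S ⟧ (A₂ ω)
        s₃ = ⟦ S ⟧ (A₃ ω)

        0≤s₁ = 0≤S (A₁ ω)
        0≤s₂ = 0≤S (A₂ ω)
        0≤s₃ = 0≤S (A₃ ω)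

        m²≤ : ∀ {x y} → R ω ≤ x → R ω ≤ y → m * m ≤ ⟦ S ⟧ x * ⟦ S ⟧ y
        m²≤ R≤x R≤y = *-mono-≤ 0≤m 0≤m
          (≤S m≤nδ (≤-trans m≤R R≤x) (≤-trans (0≤R ω) R≤x))
          (≤S m≤nδ (≤-trans m≤R R≤y) (≤-trans (0≤R ω) R≤y))

        case : TwoOf (R ω ≤_) (A₁ ω) (A₂ ω) (A₃ ω) → m * m ≤ pairs s₁ s₂ s₃
        case (inj₁ (R≤₁ , R≤₂)) = conclude (0≤diff (m²≤ R≤₁ R≤₂) ⊕ (0≤s₂ ⊗ 0≤s₃ ⊕ 0≤s₁ ⊗ 0≤s₃))
          (solve 4 (λ q x y z → x :- q :+ (y :+ z) := x :+ (y :+ z) :- q) refl (m * m) (s₁ * s₂) (s₂ * s₃) (s₁ * s₃))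
        case (inj₂ (inj₁ (R≤₂ , R≤₃))) = conclude (0≤diff (m²≤ R≤₂ R≤₃) ⊕ (0≤s₁ ⊗ 0≤s₂ ⊕ 0≤s₁ ⊗ 0≤s₃))
          (solve 4 (λ q x y z → y :- q :+ (x :+ z) := x :+ (y :+ z) :- q) refl (m * m) (s₁ * s₂) (s₂ * s₃) (s₁ * s₃))
        case (inj₂ (inj₂ (R≤₁ , R≤₃))) = conclude (0≤diff (m²≤ R≤₁ R≤₃) ⊕ (0≤s₁ ⊗ 0≤s₂ ⊕ 0≤s₂ ⊗ 0≤s₃))
          (solve 4 (λ q x y z → z :- q :+ (x :+ y) := x :+ (y :+ z) :- q) refl (m * m) (s₁ * s₂) (s₂ * s₃) (s₁ * s₃))

      e : ℝ
      e = ∫ G₁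

      0≤e : 0ℝ ≤ e
      0≤e = ∫-nonneg G₁ λ ω → subst (0ℝ ≤_) (sym (⟦pullback⟧ {𝓐 = events} rv₁ S ω)) (0≤S (A₁ ω))

      e≤D+δ : e ≤ D + δ
      e≤D+δ = Bounds-shift δ bound G₁ λ ω →
        subst (_≤ A₁ ω + δ) (sym (⟦pullback⟧ {𝓐 = events} rv₁ S ω)) (S≤ (0≤A₁ ω))

      ∫-products : ∫ products ≡ pairs e e e
      ∫-products = trans (∫-++ (product G₁ G₂) _) (cong₂ _+_
        (trans (∫-product-independent rv₁ rv₂ ind₁₂ S S) (cong (e *_) e₂))
        (trans (∫-++ (product G₂ G₃) _) (cong₂ _+_
          (trans (∫-product-independent rv₂ rv₃ ind₂₃ S S) (cong₂ _*_ e₂ e₃))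
          (trans (∫-product-independent rv₁ rv₃ ind₁₃ S S) (cong (e *_) e₃)))))
        where
        e₂ : ∫ G₂ ≡ e
        e₂ = sym (∫-identical rv₁ rv₂ id₁₂ S)

        e₃ : ∫ G₃ ≡ e
        e₃ = sym (∫-identical rv₁ rv₃ id₁₃ S)

      ∫L≤3e² : ∫ L ≤ pairs e e e
      ∫L≤3e² = subst (∫ L ≤_) ∫-products (∫-mono L products L≤products)

    approx : ∀ δ → 0ℝ < δ → δ ≤ 1ℝ → ∫ L ≤ 3ℝ * D ² + δ * ((3ℝ + 3ℝ) * D + 3ℝ)
    -- The second summand of the certificate is `3 ((D + δ)² - e²)`. Expanding `3 (D + δ)²` leaves
    -- the error `6 D δ + 3 δ²`, and the third summand uses `δ ≤ 1` to replace `3 δ²` by `3 δ`.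
    approx δ 0<δ δ≤1 = conclude
      (0≤diff ∫L≤3e² ⊕ 0≤3 ⊗ (0≤diff e≤D+δ ⊗ (0≤diff e≤D+δ ⊕ 0≤e ⊕ 0≤e)) ⊕ 0≤3 ⊗ (0≤δ ⊗ 0≤diff δ≤1))
      (solve 4 (λ l e D δ → let :3 = :1 :+ :1 :+ :1 ; d = D :+ δ :- e in
        e :* e :+ (e :* e :+ e :* e) :- l :+ :3 :* (d :* (d :+ e :+ e)) :+ :3 :* (δ :* (:1 :- δ))
        := :3 :* (D :* D) :+ δ :* ((:3 :+ :3) :* D :+ :3) :- l) refl (∫ L) e D δ)
      where open Approximation δ 0<δ

-- Minimality of the variance, and integrability of deviations.

module Variance (em : ExcludedMiddle (lsuc 0ℓ)) (ℛ : RealField) (𝒮 : ProbabilitySpace ℛ) where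
  open RealField ℛ
  open ProbabilitySpace 𝒮
  open Reals em ℛ
  open Measurability em ℛ
  open ElementaryFunctions em ℛ
  open ElementaryIntegral em ℛ 𝒮
  open Integral em ℛ 𝒮
  open IntegerCoefficients ℛ using (solve; _:=_; _:+_; _:*_; _:-_; :-_; :0; :1)

  -- For `a = 0` the claim is `0 ≤ K`, which the element `x₀` supplies; otherwise `K / a` is an
  -- upper bound of `P`.
  supremum-scale : ∀ {ℓ} {P : Pred ℝ ℓ} {a s K x₀} → 0ℝ ≤ a → IsSupremum P s → P x₀ →
                   (∀ x → P x → a * x ≤ K) → a * s ≤ K
  supremum-scale {a = a} {s} {K} {x₀} 0≤a (_ , least) p₀ ax≤K with dec (0ℝ ≡ a)
  ... | yes refl = subst (_≤ K) (solve 2 (λ x s → :0 :* x := :0 :* s) refl x₀ s) (ax≤K x₀ p₀)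
  ... | no 0≢a with positive-inverse (0≤a , 0≢a)
  ...   | i , 0≤i , ai≡1 = subst (a * s ≤_) (cancel-inverse ia≡1 K)
    (*-monoˡ-≤ 0≤a (least (i * K) λ x p → subst (_≤ i * K) (cancel-inverse ai≡1 x) (*-monoˡ-≤ 0≤i (ax≤K x p))))
    where
    ia≡1 = trans (solve 2 (λ a i → i :* a := a :* i) refl a i) ai≡1

  Bounds-scale : ∀ {f v a} → 0ℝ ≤ a → Bounds f v → Bounds (λ ω → a * f ω) (a * v)
  Bounds-scale {f} {v} {a} 0≤a bound L L≤af with dec (0ℝ ≡ a)
  ... | yes refl = subst (∫ L ≤_) (solve 1 (λ v → :0 := :0 :* v) refl v)
    (∫-mono L [] λ ω → subst (⟦ L ⟧ ω ≤_) (solve 1 (λ x → :0 :* x := :0) refl (f ω)) (L≤af ω))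
  ... | no 0≢a with positive-inverse (0≤a , 0≢a)
  ...   | i , 0≤i , ai≡1 = subst (_≤ a * v) a∫iL≡∫L (*-monoˡ-≤ 0≤a (bound (scale i L) λ ω →
    subst₂ _≤_ (sym (⟦scale⟧ i L ω)) (cancel-inverse ai≡1 (f ω)) (*-monoˡ-≤ 0≤i (L≤af ω))))
    where
    a∫iL≡∫L : a * ∫ (scale i L) ≡ ∫ L
    a∫iL≡∫L = trans (cong (a *_) (∫-scale i L))
      (trans (solve 3 (λ a i x → a :* (i :* x) := i :* (a :* x)) refl a i (∫ L)) (cancel-inverse ai≡1 (∫ L)))

  -- For a simple `s` below `Q`, the function `L + a s + k` lies below `F + a P`, which bounds
  -- `a ∫ s`. Taking the supremum over `s` brings in `a q` on the side where it is to be subtracted.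
  -- Since `a` must be nonnegative, the positive and negative parts of `Y` exchange the roles of `P`
  -- and `Q` according to the sign of `μ - 𝔼 Y`.
  Bounds-compensated : ∀ {F G P Q : Ω → ℝ} {v p q a k} → 0ℝ ≤ a →
    IsRandomVariable F → (∀ ω → 0ℝ ≤ F ω) → Bounds F v →
    (∀ ω → 0ℝ ≤ P ω) → Bounds P p →
    (∀ ω → 0ℝ ≤ Q ω) → HasIntegral⁺ Q q →
    (∀ ω → G ω + a * Q ω + k ≤ F ω + a * P ω) →
    Bounds G (v + a * p - a * q - k)
  Bounds-compensated {F} {G} {P} {Q} {v} {p} {q} {a} {k} 0≤a rvF 0≤F F-bound 0≤P P-bound 0≤Q q-integral balance L L≤G =
    conclude (0≤diff (supremum-scale 0≤a q-integral (zero-below 0≤Q) below))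
      (solve 5 (λ v ap aq k l → v :+ ap :- k :- l :- aq := v :+ ap :- aq :- k :- l) refl v (a * p) (a * q) k (∫ L))
    where
    total-bound : Bounds (λ ω → a * P ω + F ω) (a * p + v)
    total-bound = Bounds-+ (λ ω → 0≤a ⊗ 0≤P ω) (Bounds-scale 0≤a P-bound) rvF 0≤F F-bound

    below : ∀ x → LowerIntegral Q x → a * x ≤ v + a * p - k - ∫ L
    below _ (s , simple , s-between , refl) = conclude
      (0≤diff (total-bound combined λ ω → subst (_≤ a * P ω + F ω) (sym (⟦combined⟧ ω))
        (conclude (0≤diff (L≤G ω) ⊕ 0≤a ⊗ 0≤diff (proj₂ (s-between ω)) ⊕ 0≤diff (balance ω))
          (solve 8 (λ l G a s Q k F P → G :- l :+ a :* (Q :- s) :+ (F :+ a :* P :- (G :+ a :* Q :+ k))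
            := a :* P :+ F :- (l :+ (a :* s :+ k))) refl (⟦ L ⟧ ω) (G ω) a (s ω) (Q ω) k (F ω) (P ω)))))
      (trans (cong (λ z → a * p + v - z) ∫-combined)
        (solve 5 (λ ap v l as k → ap :+ v :- (l :+ (as :+ k)) := v :+ ap :- k :- l :- as) refl (a * p) v (∫ L) _ k))
      where
      open FromSimple simple

      combined : Elementary events
      combined = L ++ (scale a elementary ++ constant k)

      ⟦combined⟧ : ∀ ω → ⟦ combined ⟧ ω ≡ ⟦ L ⟧ ω + (a * s ω + k)
      ⟦combined⟧ ω = trans (⟦++⟧ L _ ω) (cong (⟦ L ⟧ ω +_)
        (trans (⟦++⟧ (scale a elementary) (constant k) ω) (cong₂ _+_
          (trans (⟦scale⟧ a elementary ω) (cong (a *_) (⟦elementary⟧ ω)))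
          (⟦constant⟧ {𝓐 = events} k ω))))

      ∫-combined : ∫ combined ≡ ∫ L + (a * IsSimple.integral simple + k)
      ∫-combined = trans (∫-++ L _) (cong (∫ L +_)
        (trans (∫-++ (scale a elementary) (constant k)) (cong₂ _+_
          (trans (∫-scale a elementary) (cong (a *_) ∫-elementary))
          (∫-constant k))))

  pos-neg : ∀ x → x ⊔ 0ℝ - ((- x) ⊔ 0ℝ) ≡ x
  pos-neg x = [ nonneg , nonpos ]′ (total 0ℝ x)
    where
    nonneg : 0ℝ ≤ x → x ⊔ 0ℝ - ((- x) ⊔ 0ℝ) ≡ x
    nonneg 0≤x = trans
      (cong₂ _-_ (x≤y⇒y⊔x≈y 0≤x) (x≤y⇒x⊔y≈y (conclude 0≤x (solve 1 (λ x → x := :0 :- (:- x)) refl x))))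
      (solve 1 (λ x → x :- :0 := x) refl x)

    nonpos : x ≤ 0ℝ → x ⊔ 0ℝ - ((- x) ⊔ 0ℝ) ≡ x
    nonpos x≤0 = trans
      (cong₂ _-_ (x≤y⇒x⊔y≈y x≤0) (x≤y⇒y⊔x≈y (0≤neg x≤0)))
      (solve 1 (λ x → :0 :- (:- x) := x) refl x)

  -- (y - c)² = (y - μ)² + 2(μ - c)(y - c) - (μ - c)², and y - c has mean zero.
  variance-minimal : ∀ {Y} (Y-int : Integrable Y) μ {v} →
    IsRandomVariable (λ ω → (Y ω - μ) ²) → Bounds (λ ω → (Y ω - μ) ²) v →
    Bounds (λ ω → (Y ω - 𝔼 Y Y-int) ²) v
  variance-minimal {Y} Y-int μ {v} rv bound with total (𝔼 Y Y-int) μ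
  ... | inj₁ c≤μ = subst (Bounds _)
    (solve 4 (λ v p q μ → let c = p :- q ; a = μ :- c :+ (μ :- c) in
      v :+ a :* p :- a :* q :- a :* c := v) refl v 𝔼⁺ 𝔼⁻ μ)
    (Bounds-compensated {k = a * c} (0≤diff c≤μ ⊕ 0≤diff c≤μ) rv (λ ω → 0≤² (Y ω - μ)) bound
      (λ ω → 0≤⊔0 (Y ω)) (positive-part-Bounds Y-int) (λ ω → 0≤⊔0 (- Y ω)) negative-part balance)
    where
    open Integrable Y-int
    c = 𝔼 Y Y-int
    a = μ - c + (μ - c)

    balance : ∀ ω → (Y ω - c) ² + a * ((- Y ω) ⊔ 0ℝ) + a * c ≤ (Y ω - μ) ² + a * (Y ω ⊔ 0ℝ)
    balance ω = subst
      (λ y → (y - c) ² + a * ((- Y ω) ⊔ 0ℝ) + a * c ≤ (y - μ) ² + a * (Y ω ⊔ 0ℝ)) (pos-neg (Y ω))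
      (conclude (0≤² (μ - c)) (solve 4 (λ p q μ c → let y = p :- q ; a = μ :- c :+ (μ :- c) in
        (μ :- c) :* (μ :- c) := (y :- μ) :* (y :- μ) :+ a :* p :- ((y :- c) :* (y :- c) :+ a :* q :+ a :* c))
        refl (Y ω ⊔ 0ℝ) ((- Y ω) ⊔ 0ℝ) μ c))
  ... | inj₂ μ≤c = subst (Bounds _)
    (solve 4 (λ v p q μ → let c = p :- q ; a = c :- μ :+ (c :- μ) in
      v :+ a :* q :- a :* p :- (:- (a :* c)) := v) refl v 𝔼⁺ 𝔼⁻ μ)
    (Bounds-compensated {k = - (a * c)} (0≤diff μ≤c ⊕ 0≤diff μ≤c) rv (λ ω → 0≤² (Y ω - μ)) bound
      (λ ω → 0≤⊔0 (- Y ω)) (negative-part-Bounds Y-int) (λ ω → 0≤⊔0 (Y ω)) positive-part balance)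
    where
    open Integrable Y-int
    c = 𝔼 Y Y-int
    a = c - μ + (c - μ)

    balance : ∀ ω → (Y ω - c) ² + a * (Y ω ⊔ 0ℝ) + - (a * c) ≤ (Y ω - μ) ² + a * ((- Y ω) ⊔ 0ℝ)
    balance ω = subst
      (λ y → (y - c) ² + a * (Y ω ⊔ 0ℝ) + - (a * c) ≤ (y - μ) ² + a * ((- Y ω) ⊔ 0ℝ)) (pos-neg (Y ω))
      (conclude (0≤² (μ - c)) (solve 4 (λ p q μ c → let y = p :- q ; a = c :- μ :+ (c :- μ) in
        (μ :- c) :* (μ :- c) := (y :- μ) :* (y :- μ) :+ a :* q :- ((y :- c) :* (y :- c) :+ a :* p :+ (:- (a :* c))))
        refl (Y ω ⊔ 0ℝ) ((- Y ω) ⊔ 0ℝ) μ c))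

  distance-measurable : ∀ μ → SublevelMeasurable borel (λ x → ∣ x - μ ∣)
  distance-measurable μ = valley⇒Borel μ
    (λ {x} {y} μ≤x x≤y → ∣∣-lub
      (≤-trans (+-mono-≤ x≤y ≤-refl) (a≤∣a∣ (y - μ)))
      (≤-trans (conclude (0≤diff μ≤x ⊕ (0≤diff μ≤x ⊕ 0≤diff x≤y))
        (solve 3 (λ x y μ → x :- μ :+ (x :- μ :+ (y :- x)) := y :- μ :- (:- (x :- μ))) refl x y μ)) (a≤∣a∣ (y - μ))))
    (λ {x} {y} y≤μ x≤y → ∣∣-lub
      (≤-trans (conclude (0≤diff y≤μ ⊕ (0≤diff y≤μ ⊕ 0≤diff x≤y))
        (solve 3 (λ x y μ → μ :- y :+ (μ :- y :+ (y :- x)) := (:- (x :- μ)) :- (y :- μ)) refl x y μ)) (-a≤∣a∣ (x - μ)))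
      (≤-trans (conclude (0≤diff x≤y)
        (solve 3 (λ x y μ → y :- x := (:- (x :- μ)) :- (:- (y :- μ))) refl x y μ)) (-a≤∣a∣ (x - μ))))

  squared-distance-measurable : ∀ μ → SublevelMeasurable borel (λ x → (x - μ) ²)
  squared-distance-measurable μ = valley⇒Borel μ
    (λ {x} {y} μ≤x x≤y → conclude (0≤diff x≤y ⊗ (0≤diff μ≤x ⊕ (0≤diff μ≤x ⊕ 0≤diff x≤y)))
      (solve 3 (λ x y μ → (y :- x) :* (x :- μ :+ (x :- μ :+ (y :- x)))
        := (y :- μ) :* (y :- μ) :- (x :- μ) :* (x :- μ)) refl x y μ))
    (λ {x} {y} y≤μ x≤y → conclude (0≤diff x≤y ⊗ (0≤diff y≤μ ⊕ (0≤diff y≤μ ⊕ 0≤diff x≤y)))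
      (solve 3 (λ x y μ → (y :- x) :* (μ :- y :+ (μ :- y :+ (y :- x)))
        := (x :- μ) :* (x :- μ) :- (y :- μ) :* (y :- μ)) refl x y μ))

  x≤x²+1 : ∀ x → x ≤ x ² + 1ℝ
  x≤x²+1 x with total x 1ℝ
  ... | inj₁ x≤1 = conclude (0≤² x ⊕ 0≤diff x≤1) (solve 1 (λ x → x :* x :+ (:1 :- x) := x :* x :+ :1 :- x) refl x)
  ... | inj₂ 1≤x = conclude ((0≤diff 1≤x ⊕ 0≤1) ⊗ 0≤diff 1≤x ⊕ 0≤1)
    (solve 1 (λ x → (x :- :1 :+ :1) :* (x :- :1) :+ :1 := x :* x :+ :1 :- x) refl x)

  -- From `t ≤ t² + 1` with `t = y - μ` and `t = μ - y`, both `y` and `- y` are at most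
  -- `(y - μ)² + 1 + ∣ μ ∣`.
  square-integrable⇒integrable : ∀ {Y} μ {v} → IsRandomVariable Y →
    Bounds (λ ω → (Y ω - μ) ²) v → Integrable Y
  square-integrable⇒integrable {Y} μ rv bound = integrable rv
    (Bounds-anti (λ ω → ⊔-lub (above (Y ω)) (nonneg (Y ω))) (Bounds-shift (1ℝ + ∣ μ ∣) bound))
    (Bounds-anti (λ ω → ⊔-lub (below (Y ω)) (nonneg (Y ω))) (Bounds-shift (1ℝ + ∣ μ ∣) bound))
    where
    nonneg : ∀ y → 0ℝ ≤ (y - μ) ² + (1ℝ + ∣ μ ∣)
    nonneg y = 0≤² (y - μ) ⊕ (0≤1 ⊕ 0≤∣a∣ μ)

    above : ∀ y → y ≤ (y - μ) ² + (1ℝ + ∣ μ ∣)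
    above y = conclude (0≤diff (x≤x²+1 (y - μ)) ⊕ 0≤diff (a≤∣a∣ μ))
      (solve 3 (λ y μ m → (y :- μ) :* (y :- μ) :+ :1 :- (y :- μ) :+ (m :- μ)
        := (y :- μ) :* (y :- μ) :+ (:1 :+ m) :- y) refl y μ ∣ μ ∣)

    below : ∀ y → - y ≤ (y - μ) ² + (1ℝ + ∣ μ ∣)
    below y = conclude (0≤diff (x≤x²+1 (μ - y)) ⊕ 0≤diff (-a≤∣a∣ μ))
      (solve 3 (λ y μ m → (μ :- y) :* (μ :- y) :+ :1 :- (μ :- y) :+ (m :- (:- μ))
        := (y :- μ) :* (y :- μ) :+ (:1 :+ m) :- (:- y)) refl y μ ∣ μ ∣)

  -- The deviation is dominated by the sum of the positive and negative parts of `X` and `∣ μ ∣`.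
  absolute-deviation-Bounds : ∀ {X} (X-int : Integrable X) μ →
    Bounds (λ ω → ∣ X ω - μ ∣) (Integrable.𝔼⁺ X-int + Integrable.𝔼⁻ X-int + ∣ μ ∣)
  absolute-deviation-Bounds {X} X-int μ = Bounds-anti
    (λ ω → ∣∣-lub
      (conclude (0≤diff (x≤x⊔y (X ω) 0ℝ) ⊕ 0≤⊔0 (- X ω) ⊕ 0≤diff (-a≤∣a∣ μ))
        (solve 5 (λ x p q μ m → p :- x :+ q :+ (m :- (:- μ)) := p :+ q :+ m :- (x :- μ)) refl (X ω) _ _ μ _))
      (conclude (0≤diff (x≤x⊔y (- X ω) 0ℝ) ⊕ 0≤⊔0 (X ω) ⊕ 0≤diff (a≤∣a∣ μ))
        (solve 5 (λ x p q μ m → q :- (:- x) :+ p :+ (m :- μ) := p :+ q :+ m :- (:- (x :- μ))) refl (X ω) _ _ μ _)))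
    (Bounds-shift ∣ μ ∣ (Bounds-+ (λ ω → 0≤⊔0 (X ω)) (positive-part-Bounds X-int)
      (negative-part-isRandomVariable X-int) (λ ω → 0≤⊔0 (- X ω)) (negative-part-Bounds X-int)))

-- The median of three and its measurability.

data AtLeastTwo {A : Set} (P : Pred A 0ℓ) : Pred (List A) 0ℓ where
  now   : ∀ {x xs} → P x → Any P xs → AtLeastTwo P (x ∷ xs)
  later : ∀ {x xs} → AtLeastTwo P xs → AtLeastTwo P (x ∷ xs)

-- Counting in lists of any length permits induction on the permutation, where a swap or a
-- transitive step need not display the three entries.
AtLeastTwo-resp-↭ : ∀ {A} {P : Pred A 0ℓ} {xs ys} → xs ↭ ys → AtLeastTwo P xs → AtLeastTwo P ys
AtLeastTwo-resp-↭ ↭.refl         two                   = two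
AtLeastTwo-resp-↭ (↭.prep _ σ)   (now p any)           = now p (Any-resp-↭ σ any)
AtLeastTwo-resp-↭ (↭.prep _ σ)   (later two)           = later (AtLeastTwo-resp-↭ σ two)
AtLeastTwo-resp-↭ (↭.swap _ _ σ) (now p (here q))      = now q (here p)
AtLeastTwo-resp-↭ (↭.swap _ _ σ) (now p (there any))   = later (now p (Any-resp-↭ σ any))
AtLeastTwo-resp-↭ (↭.swap _ _ σ) (later (now q any))   = now q (there (Any-resp-↭ σ any))
AtLeastTwo-resp-↭ (↭.swap _ _ σ) (later (later two))   = later (later (AtLeastTwo-resp-↭ σ two))
AtLeastTwo-resp-↭ (↭.trans σ τ)  two                   = AtLeastTwo-resp-↭ τ (AtLeastTwo-resp-↭ σ two)

module MedianOfThree (em : ExcludedMiddle (lsuc 0ℓ)) (ℛ : RealField) (𝒮 : ProbabilitySpace ℛ) where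
  open RealField ℛ
  open ProbabilitySpace 𝒮
  open Reals em ℛ
  open Measurability em ℛ
  open ElementaryIntegral em ℛ 𝒮
  open Integral em ℛ 𝒮
  open Independence em ℛ 𝒮
  open Variance em ℛ 𝒮
  open IntegerCoefficients ℛ using (solve; _:=_; _:+_; _:*_; _:-_; :-_; :1)

  fromTwoOf : ∀ {P x y z} → TwoOf P x y z → AtLeastTwo P (x ∷ y ∷ z ∷ [])
  fromTwoOf (inj₁ (p , q))        = now p (here q)
  fromTwoOf (inj₂ (inj₁ (q , r))) = later (now q (here r))
  fromTwoOf (inj₂ (inj₂ (p , r))) = now p (there (here r))

  toTwoOf : ∀ {P x y z} → AtLeastTwo P (x ∷ y ∷ z ∷ []) → TwoOf P x y z
  toTwoOf (now p (here q))          = inj₁ (p , q)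
  toTwoOf (now p (there (here r)))  = inj₂ (inj₂ (p , r))
  toTwoOf (later (now q (here r)))  = inj₂ (inj₁ (q , r))
  toTwoOf (later (later (now _ ())))
  toTwoOf (later (later (later ())))

  TwoOf-resp-↭ : ∀ {P x y z x′ y′ z′} → (x ∷ y ∷ z ∷ []) ↭ (x′ ∷ y′ ∷ z′ ∷ []) →
                 TwoOf P x y z → TwoOf P x′ y′ z′
  TwoOf-resp-↭ σ = toTwoOf ∘ AtLeastTwo-resp-↭ σ ∘ fromTwoOf

  median≤⇒TwoOf : ∀ {x y z m c} → IsMedian x y z m → m ≤ c → TwoOf (_≤ c) x y z
  median≤⇒TwoOf (_ , _ , σ , l≤m , _) m≤c = TwoOf-resp-↭ σ (inj₁ (≤-trans l≤m m≤c , m≤c))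

  TwoOf⇒median≤ : ∀ {x y z m c} → IsMedian x y z m → TwoOf (_≤ c) x y z → m ≤ c
  TwoOf⇒median≤ {c = c} (l , u , σ , _ , m≤u) two = sorted (TwoOf-resp-↭ (↭-sym σ) two)
    where
    sorted : TwoOf (_≤ c) l _ u → _ ≤ c
    sorted (inj₁ (_ , m≤c))        = m≤c
    sorted (inj₂ (inj₁ (m≤c , _))) = m≤c
    sorted (inj₂ (inj₂ (_ , u≤c))) = ≤-trans m≤u u≤c

  median-deviation : ∀ {x y z m} μ → IsMedian x y z m →
                     TwoOf (λ d → ∣ m - μ ∣ ≤ ∣ d - μ ∣) x y z
  median-deviation {m = m} μ (l , u , σ , l≤m , m≤u) = TwoOf-resp-↭ σ (sorted (total μ m))
    where
    further-up : μ ≤ m → ∣ m - μ ∣ ≤ ∣ u - μ ∣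
    further-up μ≤m = ∣∣-lub
      (≤-trans (+-mono-≤ m≤u ≤-refl) (a≤∣a∣ (u - μ)))
      (≤-trans (conclude (0≤diff μ≤m ⊕ 0≤diff (≤-trans μ≤m m≤u))
        (solve 3 (λ m u μ → m :- μ :+ (u :- μ) := u :- μ :- (:- (m :- μ))) refl m u μ)) (a≤∣a∣ (u - μ)))

    further-down : m ≤ μ → ∣ m - μ ∣ ≤ ∣ l - μ ∣
    further-down m≤μ = ∣∣-lub
      (≤-trans (conclude (0≤diff m≤μ ⊕ 0≤diff (≤-trans l≤m m≤μ))
        (solve 3 (λ m l μ → μ :- m :+ (μ :- l) := (:- (l :- μ)) :- (m :- μ)) refl m l μ)) (-a≤∣a∣ (l - μ)))
      (≤-trans (conclude (0≤diff l≤m)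
        (solve 3 (λ m l μ → m :- l := (:- (l :- μ)) :- (:- (m :- μ))) refl m l μ)) (-a≤∣a∣ (l - μ)))

    sorted : μ ≤ m ⊎ m ≤ μ → TwoOf (λ d → ∣ m - μ ∣ ≤ ∣ d - μ ∣) l m u
    sorted (inj₁ μ≤m) = inj₂ (inj₁ (≤-refl , further-up μ≤m))
    sorted (inj₂ m≤μ) = inj₁ (further-down m≤μ , ≤-refl)

  -- The median is at most `c` exactly when at least two of the three values are, so its sublevel
  -- sets are finite unions of intersections of events.
  median-isRandomVariable : ∀ {X₁ X₂ X₃ Y : Ω → ℝ} →
    IsRandomVariable X₁ → IsRandomVariable X₂ → IsRandomVariable X₃ →
    (∀ ω → IsMedian (X₁ ω) (X₂ ω) (X₃ ω) (Y ω)) → IsRandomVariable Y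
  median-isRandomVariable rv₁ rv₂ rv₃ median = preimage-measurable events λ c → Event-resp
    ((λ {ω} → TwoOf⇒median≤ (median ω)) , λ {ω} → median≤⇒TwoOf (median ω))
    (∪-closed (∩-closed events (rv₁ (ray c)) (rv₂ (ray c)))
      (∪-closed (∩-closed events (rv₂ (ray c)) (rv₃ (ray c)))
                (∩-closed events (rv₁ (ray c)) (rv₃ (ray c)))))
    where open SigmaAlgebra events using (∪-closed)

  module _ {X₁ X₂ X₃ : Ω → ℝ} (iid : IID₃ X₁ X₂ X₃) where
    open IID₃ iid

    private
      a*b*1 : ∀ {a b} → a * b * ℙ U ≡ a * b
      a*b*1 {a} {b} = trans (cong (a * b *_) ℙ-U) (solve 2 (λ a b → a :* b :* :1 := a :* b) refl a b)

    independent₁₂ : Independent₂ X₁ X₂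
    independent₁₂ b b′ = trans
      (ℙ-resp ((λ (p , q) → p , q , _) , λ (p , q , _) → p , q)
        (∩-closed events (isRandomVariable₁ b) (isRandomVariable₂ b′)))
      (trans (independent b b′ Borel-U) a*b*1)

    independent₂₃ : Independent₂ X₂ X₃
    independent₂₃ b b′ = trans
      (ℙ-resp ((λ (p , q) → _ , p , q) , λ (_ , p , q) → p , q)
        (∩-closed events (isRandomVariable₂ b) (isRandomVariable₃ b′)))
      (trans (independent Borel-U b b′) (trans
        (cong (λ u → u * _ * _) ℙ-U) (solve 2 (λ a b → :1 :* a :* b := a :* b) refl _ _)))

    independent₁₃ : Independent₂ X₁ X₃
    independent₁₃ b b′ = trans
      (ℙ-resp ((λ (p , q) → p , _ , q) , λ (p , _ , q) → p , q)
        (∩-closed events (isRandomVariable₁ b) (isRandomVariable₃ b′)))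
      (trans (independent b Borel-U b′) (trans
        (cong (λ u → _ * u * _) ℙ-U) (solve 2 (λ a b → a :* :1 :* b := a :* b) refl _ _)))

    median-second-moment : ∀ {Y : Ω → ℝ} μ {D} → (∀ ω → IsMedian (X₁ ω) (X₂ ω) (X₃ ω) (Y ω)) →
      Bounds (λ ω → ∣ X₁ ω - μ ∣) D → Bounds (λ ω → (Y ω - μ) ²) (3ℝ * D ²)
    -- The bound compares a nonnegative `R` with the distances, so it is applied to `∣ Y - μ ∣`. The
    -- distances inherit their law and independence because preimages of Borel sets under the
    -- distance are Borel.
    median-second-moment {Y} μ median bound = Bounds-anti (λ ω → a²≤∣a∣² (Y ω - μ))
      (second-moment-bound
        (∘-isRandomVariable isRandomVariable₁ distance)
        (∘-isRandomVariable isRandomVariable₂ distance)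
        (∘-isRandomVariable isRandomVariable₃ distance)
        (λ b → identical₁₂ (distance⁻¹ b)) (λ b → identical₁₃ (distance⁻¹ b))
        (λ b b′ → independent₁₂ (distance⁻¹ b) (distance⁻¹ b′))
        (λ b b′ → independent₂₃ (distance⁻¹ b) (distance⁻¹ b′))
        (λ b b′ → independent₁₃ (distance⁻¹ b) (distance⁻¹ b′))
        (λ ω → 0≤∣a∣ _) (λ ω → 0≤∣a∣ _) (λ ω → 0≤∣a∣ _) (λ ω → 0≤∣a∣ (Y ω - μ))
        (λ ω → median-deviation μ (median ω))
        bound)
      where
      distance = distance-measurable μ

      distance⁻¹ : ∀ {B} → Borel B → Borel ((λ x → ∣ x - μ ∣) ⊢ B)
      distance⁻¹ = preimage-measurable borel distance

      a²≤∣a∣² : ∀ a → a ² ≤ ∣ a ∣ ²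
      a²≤∣a∣² a = conclude (0≤diff (a≤∣a∣ a) ⊗ 0≤diff (-a≤∣a∣ a))
        (solve 2 (λ a m → (m :- a) :* (m :- (:- a)) := m :* m :- a :* a) refl a ∣ a ∣)

-- The two inequalities, with the existence of all expectations involved.

corollary1 : ExcludedMiddle (lsuc 0ℓ) →
    (ℛ : RealField) (𝒮 : ProbabilitySpace ℛ) →
    let open RealField ℛ
        open ProbabilitySpace 𝒮
    in
    (X₁ X₂ X₃ : Ω → ℝ) → IID₃ X₁ X₂ X₃ →
    (X₁-int : Integrable X₁) →
    (Y : Ω → ℝ) → (∀ ω → IsMedian (X₁ ω) (X₂ ω) (X₃ ω) (Y ω)) →
    let μ = 𝔼 X₁ X₁-int in
    Σ[ Y-int ∈ Integrable Y ]
    Σ[ V-int ∈ Integrable (λ ω → (Y ω - 𝔼 Y Y-int) ²) ]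
    Σ[ M-int ∈ Integrable (λ ω → (Y ω - μ) ²) ]
    Σ[ D-int ∈ Integrable (λ ω → ∣ X₁ ω - μ ∣) ]
      Var Y Y-int V-int ≤ 𝔼 (λ ω → (Y ω - μ) ²) M-int ×
      𝔼 (λ ω → (Y ω - μ) ²) M-int ≤ 3ℝ * 𝔼 (λ ω → ∣ X₁ ω - μ ∣) D-int ²
corollary1 em ℛ 𝒮 X₁ X₂ X₃ iid X₁-int Y median =
  Y-int , proj₁ V , proj₁ M , proj₁ D ,
  proj₂ (proj₂ V) _ V-bound , proj₂ (proj₂ M) _ M-bound
  where
  open RealField ℛ
  open ProbabilitySpace 𝒮
  open IID₃ iid
  open Reals em ℛ using (0≤∣a∣; 0≤²)
  open Integral em ℛ 𝒮
  open Variance em ℛ 𝒮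
  open MedianOfThree em ℛ 𝒮

  μ = 𝔼 X₁ X₁-int

  D : Σ[ int ∈ Integrable (λ ω → ∣ X₁ ω - μ ∣) ]
      Bounds (λ ω → ∣ X₁ ω - μ ∣) (𝔼 _ int) × (∀ c → Bounds (λ ω → ∣ X₁ ω - μ ∣) c → 𝔼 _ int ≤ c)
  D = nonneg-integrable (∘-isRandomVariable isRandomVariable₁ (distance-measurable μ))
    (λ ω → 0≤∣a∣ (X₁ ω - μ)) (absolute-deviation-Bounds X₁-int μ)

  Y-rv : IsRandomVariable Y
  Y-rv = median-isRandomVariable isRandomVariable₁ isRandomVariable₂ isRandomVariable₃ median

  squared-rv : ∀ c → IsRandomVariable (λ ω → (Y ω - c) ²)
  squared-rv c = ∘-isRandomVariable Y-rv (squared-distance-measurable c)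

  M-bound : Bounds (λ ω → (Y ω - μ) ²) (3ℝ * 𝔼 _ (proj₁ D) ²)
  -- The estimate precedes the expectations: it makes the second moment about `μ` finite, and
  -- through it `Y` integrable.
  M-bound = median-second-moment iid μ median (proj₁ (proj₂ D))

  M = nonneg-integrable (squared-rv μ) (λ ω → 0≤² (Y ω - μ)) M-bound

  Y-int : Integrable Y
  Y-int = square-integrable⇒integrable μ Y-rv M-bound

  V-bound : Bounds (λ ω → (Y ω - 𝔼 Y Y-int) ²) (𝔼 _ (proj₁ M))
  -- The value fed in is the second moment about `μ` itself, which bounds its own function;
  -- leastness of the variance then gives the first inequality.
  V-bound = variance-minimal Y-int μ (squared-rv μ) (proj₁ (proj₂ M))

  V = nonneg-integrable (squared-rv (𝔼 Y Y-int)) (λ ω → 0≤² (Y ω - 𝔼 Y Y-int)) V-bound
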